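{- Let $D\ge1$ and $M\ge0$ be integers. With $d=D-1$, $s_d=d(d+1)/2$, $E=\bigl(\sum_{k=2}^{D+1}k-s_d\bigr)M+2$ and $h(x,z)=(1-x)\prod_{k=1}^{d}\bigl((1+z)^{k}-x\bigr)$, $$G[M^{(D)}]=\frac{(DM)!}{(M!)^{D}}\;[z^{DM}]\;(1+z)^{E}\int_0^1h(x,z)^{M}\,dx.$$
   Context: Let $S$ be the hyper-Catalan generating series in the $D$ variables $t_2,\dots,t_{D+1}$: the unique formal power series with $S=1+\sum_{k=2}^{D+1}t_kS^{k}$. The Geode $G$ is the formal power series defined by $S-1=(t_2+\cdots+t_{D+1})\,G$. $G[M^{(D)}]$ denotes the coefficient of $(t_2t_3\cdots t_{D+1})^{M}$ in $G$. $[z^{j}]$ denotes the coefficient of $z^{j}$. -}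

module Defs where

open import Algebra.Bundles using (RawRing)
import Algebra.Definitions.RawMonoid as RawMonoidDefs
import Algebra.Definitions.RawSemiring as RawSemiringDefs
open import Data.Bool.Base using (if_then_else_)
open import Data.Fin.Base using (Fin; toℕ)
open import Data.Integer.Base using (+_)
open import Data.List.Base using (List; []; _∷_; map; length; lookup)
open import Data.Nat.Base as ℕ using (ℕ; zero; suc; _∸_; _!; NonZero)
import Data.Nat.Properties as ℕₚ
open import Data.Rational.Base as ℚ using (ℚ; 0ℚ; 1ℚ)
open import Data.Vec.Base as Vec using (Vec; []; _∷_; replicate; _[_]≔_)
open import Data.Vec.Properties using (≡-dec)
open import Level using (Level; 0ℓ)
open import Relation.Binary.PropositionalEquality using (_≡_)
open import Relation.Nullary.Decidable.Core using (does)

private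
  variable
    c ℓ : Level

------------------------------------------------------------------------
-- Formal power series over ℚ in n variables

-- A multi-index α stands for the monomial with exponent αᵢ in the i-th variable.

MultiIndex : ℕ → Set
MultiIndex n = Vec ℕ n

PowerSeries : ℕ → Set
PowerSeries n = MultiIndex n → ℚ

-- Σ[β+γ≡ α ] f  is the sum of  f β γ  over all pairs with  β + γ = α.

Σ[β+γ≡_] : ∀ {n} → MultiIndex n → (MultiIndex n → MultiIndex n → ℚ) → ℚ
Σ[β+γ≡ []    ] f = f [] []
Σ[β+γ≡ a ∷ α ] f = sum {suc a} λ i →
  Σ[β+γ≡ α ] λ β γ → f (toℕ i ∷ β) (a ∸ toℕ i ∷ γ)
  where open RawMonoidDefs ℚ.+-0-rawMonoid using (sum)

monomial : ∀ {n} → MultiIndex n → PowerSeries n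
monomial α β = if does (≡-dec ℕₚ._≟_ α β) then 1ℚ else 0ℚ

powerSeriesRawRing : ℕ → RawRing 0ℓ 0ℓ
powerSeriesRawRing n = record
  { Carrier = PowerSeries n
  ; _≈_     = λ f g → ∀ α → f α ≡ g α
  ; _+_     = λ f g α → f α ℚ.+ g α
  ; _*_     = λ f g α → Σ[β+γ≡ α ] λ β γ → f β ℚ.* g γ
  ; -_      = λ f α → ℚ.- f α
  ; 0#      = λ _ → 0ℚ
  ; 1#      = monomial (replicate n 0)
  }

------------------------------------------------------------------------
-- The hyper-Catalan series and the Geode

module _ (D : ℕ) where
  open RawRing (powerSeriesRawRing D)
  open RawSemiringDefs rawSemiring using (_^_; sum)

  -- Variables are indexed by i = k - 2, so  t i  is the variable t₂₊ᵢ.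

  t : Fin D → PowerSeries D
  t i = monomial (replicate D 0 [ i ]≔ 1)

  IsHyperCatalan : PowerSeries D → Set
  IsHyperCatalan S = S ≈ 1# + sum (λ i → t i * S ^ (2 ℕ.+ toℕ i))

  IsGeode : PowerSeries D → PowerSeries D → Set
  IsGeode S G = S + (- 1#) ≈ sum t * G

------------------------------------------------------------------------
-- Univariate polynomials

-- a₀ ∷ a₁ ∷ … ∷ aₙ ∷ []  represents  a₀ + a₁ X + … + aₙ Xⁿ.  Trailing zeros are
-- allowed, so equality of polynomials is equality of all coefficients.

module _ (R : RawRing c ℓ) where
  open RawRing R

  coeff : ℕ → List Carrier → Carrier
  coeff _       []      = 0#
  coeff zero    (a ∷ _) = a
  coeff (suc j) (_ ∷ p) = coeff j p

  _⊕_ : List Carrier → List Carrier → List Carrier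
  []      ⊕ q       = q
  (a ∷ p) ⊕ []      = a ∷ p
  (a ∷ p) ⊕ (b ∷ q) = (a + b) ∷ (p ⊕ q)

  _⊛_ : List Carrier → List Carrier → List Carrier
  []      ⊛ q = []
  (a ∷ p) ⊛ q = map (a *_) q ⊕ (0# ∷ (p ⊛ q))

  polynomialRawRing : RawRing c ℓ
  polynomialRawRing = record
    { Carrier = List Carrier
    ; _≈_     = λ p q → ∀ j → coeff j p ≈ coeff j q
    ; _+_     = _⊕_
    ; _*_     = _⊛_
    ; -_      = map (-_)
    ; 0#      = []
    ; 1#      = 1# ∷ []
    }

ℚ[z] : RawRing 0ℓ 0ℓ
ℚ[z] = polynomialRawRing ℚ.+-*-rawRing

ℚ[z][x] : RawRing 0ℓ 0ℓ
ℚ[z][x] = polynomialRawRing ℚ[z]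

[z^_] : ℕ → RawRing.Carrier ℚ[z] → ℚ
[z^ j ] = coeff ℚ.+-*-rawRing j

1+z : RawRing.Carrier ℚ[z]
1+z = 1ℚ ∷ 1ℚ ∷ []

-- Integration with respect to x, term by term: ∫₀¹ xⁱ dx = 1 / (i + 1).

∫₀¹_dx : RawRing.Carrier ℚ[z][x] → RawRing.Carrier ℚ[z]
∫₀¹ p dx = sum {length p} λ i → map ((+ 1 ℚ./ suc (toℕ i)) ℚ.*_) (lookup p i)
  where open RawSemiringDefs (RawRing.rawSemiring ℚ[z]) using (sum)

-- The product over k = 1, …, d is indexed by i = k - 1.

h : ℕ → RawRing.Carrier ℚ[z][x]
h d = (1# + (- x)) * product {d} (λ i → const (1+z ^ᶻ (suc (toℕ i))) + (- x))
  where
  open RawRing ℚ[z][x]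
  open RawSemiringDefs rawSemiring using (product)
  open RawSemiringDefs (RawRing.rawSemiring ℚ[z]) using () renaming (_^_ to _^ᶻ_)

  const : RawRing.Carrier ℚ[z] → Carrier
  const a = a ∷ []

  x : Carrier
  x = RawRing.0# ℚ[z] ∷ RawRing.1# ℚ[z] ∷ []

------------------------------------------------------------------------
-- The closed form

s : ℕ → ℕ
s d = d ℕ.* (d ℕ.+ 1) ℕ./ 2

-- The truncated subtraction is exact when d = D - 1 ≥ 0: the difference is then 2 D.

E : ℕ → ℕ → ℕ
E D M = (sum {D} (λ i → 2 ℕ.+ toℕ i) ∸ s (D ∸ 1)) ℕ.* M ℕ.+ 2
  where open RawMonoidDefs ℕ.+-0-rawMonoid using (sum)

multinomial : ℕ → ℕ → ℚ
multinomial D M = + ((D ℕ.* M) !) ℚ./ ((M !) ℕ.^ D)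
  where instance
    [M!]^D≢0 : NonZero ((M !) ℕ.^ D)
    [M!]^D≢0 = ℕₚ.m^n≢0 (M !) D {{M ℕₚ.!≢0}}

closedForm : ℕ → ℕ → ℚ
closedForm D M =
  multinomial D M ℚ.* [z^ D ℕ.* M ] ((1+z ^ E D M) * ∫₀¹ h (D ∸ 1) ^ˣ M dx)
  where
  open RawRing ℚ[z] using (_*_; rawSemiring)
  open RawSemiringDefs rawSemiring using (_^_)
  open RawSemiringDefs (RawRing.rawSemiring ℚ[z][x]) using () renaming (_^_ to _^ˣ_)

{-# OPTIONS --safe #-}
module Submission where

-- Write u = 1 + z and, for a multi-index α, |α| = Σ αᵢ and K = Σ (i + 2) αᵢ, where i = 0, 1, …
-- numbers the variables.  The proof computes every coefficient of the Geode: for |α| = N,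
--
--   [t ^ α] G = N! / Π αᵢ! · [z ^ N] u ^ (2 N + 2) ∫₀¹ Π (u ^ i - x) ^ αᵢ dx,
--
-- and α = (M, …, M) is the theorem (geodeCoefficient-diagonal).
--
-- The hyper-Catalan series.  Multiplication by tᵢ shifts coefficients, so the defining equation
-- times S ^ j reads, with terms for αᵢ = 0 left out,
--
--   [t ^ α] S ^ (j + 1) = [t ^ α] S ^ j + Σᵢ [t ^ (α - eᵢ)] S ^ (i + 2 + j).
--
-- By induction on |α| and then on j this determines all powers of S, and the closed form
-- j (K + j - 1)! / ((K + j - |α|)! Π αᵢ!) satisfies it unless α and j
-- are both 0 (power-coefficient).  For j = 1 and |α| = N + 1 it gives
-- [t ^ α] S = K! / ((K - N)! Π αᵢ!) (hyperCatalan-coefficient).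
--
-- The Geode.  Its defining equation says Σᵢ [t ^ (α - eᵢ)] G = [t ^ α] S for all α ≠ 0, and these
-- sums determine G (Σ-shift-injective).  It remains to check them for the claimed coefficients
-- (Σ-shift-geodeCoefficient).  Let |α| = N + 1 and H = Π (u ^ i - x) ^ αᵢ.  Lowering αᵢ by one
-- multiplies 1 / Π αᵢ! by αᵢ, so the sum over i is
--
--   N! / Π αᵢ! · [z ^ N] u ^ (2 N + 2) ∫₀¹ (- dH/dx) dx,
--
-- and the integral is H(0) - H(1).  Each u ^ i - 1 is divisible by z, hence H(1) by z ^ (N + 1),
-- so only H(0) = u ^ (Σ i αᵢ) contributes.  As 2 (N + 1) + Σ i αᵢ = K, what is left is
-- N! [z ^ N] u ^ K / Π αᵢ! = K! / ((K - N)! Π αᵢ!), as required (extract-Σ∂, coeff-[1+z]^).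

open import Algebra.Bundles using (CommutativeMonoid; CommutativeRing; RawRing)
import Algebra.Construct.Pointwise as Pointwise
import Algebra.Definitions.RawMonoid as RawMonoidDefs
import Algebra.Definitions.RawSemiring as RawSemiringDefs
import Algebra.Morphism.RingMonomorphism as RingMonomorphism
open import Algebra.Morphism.Structures using (IsRingMonomorphism)
import Algebra.Properties.CommutativeMonoid.Mult as CommutativeMonoidMult
import Algebra.Properties.CommutativeMonoid.Sum as CommutativeMonoidSum
import Algebra.Properties.CommutativeSemigroup as CommutativeSemigroupProperties
import Algebra.Properties.CommutativeSemiring.Exp as CommutativeSemiringExp
import Algebra.Properties.Group as GroupProperties
import Algebra.Properties.Ring as RingProperties
import Algebra.Properties.Semiring.Exp as SemiringExp
import Algebra.Properties.Semiring.Mult as SemiringMult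
import Algebra.Properties.Semiring.Sum as SemiringSum
import Algebra.Solver.Ring.NaturalCoefficients.Default as NaturalCoefficients
open import Algebra.Structures using (IsCommutativeRing)
open import Data.Empty using (⊥-elim)
open import Data.Fin.Base using (Fin; zero; suc; toℕ)
open import Data.Integer.Base as ℤ using (+_)
import Data.Integer.Properties as ℤₚ
open import Data.List.Base using (List; []; _∷_; map; length) renaming (lookup to lookupₗ)
open import Data.Nat.Base as ℕ using (ℕ; zero; suc; _∸_; _!; _≤_; s≤s; NonZero)
import Data.Nat.DivMod as ℕ
import Data.Nat.Properties as ℕₚ
import Data.Nat.Tactic.RingSolver as ℕ-Solver
open import Data.Product.Base using (_,_)
open import Data.Rational.Base as ℚ using (ℚ; 0ℚ; 1ℚ; toℚᵘ)
import Data.Rational.Properties as ℚₚ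
open import Data.Rational.Unnormalised.Base using (mkℚᵘ; *≡*; _≃_)
import Data.Rational.Unnormalised.Properties as ℚᵘₚ
open import Data.Vec.Base using ([]; _∷_; replicate; lookup; updateAt)
open import Data.Vec.Properties using (≡-dec)
open import Defs
open import Function.Base using (_∘_)
open import Level using (Level; 0ℓ)
open import Relation.Binary.PropositionalEquality
  using (_≡_; refl; sym; trans; cong; cong₂; subst; module ≡-Reasoning)
import Relation.Binary.Reasoning.Setoid as ≈-Reasoning
open import Relation.Nullary.Decidable.Core using (yes; no)

------------------------------------------------------------------------
-- Formal power series in one variable

-- The ring laws are proved for sequences of coefficients under the Cauchy product, and carried
-- over to polynomials and to power series in several variables along injective homomorphisms.

module FormalSeries {c ℓ : Level} (R : CommutativeRing c ℓ) where
  open CommutativeRing R hiding (zero; refl; sym; trans)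
  open CommutativeRing R using () renaming (refl to ≈-refl; sym to ≈-sym; trans to ≈-trans)
  open SemiringSum semiring using (sum; sum-cong-≋; *-distribˡ-sum)
  open CommutativeMonoidSum +-commutativeMonoid using (∑-distrib-+)
  open NaturalCoefficients commutativeSemiring using (solve; _:=_; _:+_; _:*_; con)
  open ≈-Reasoning setoid

  -- A series is its sequence of coefficients.

  Series : Set c
  Series = ℕ → Carrier

  infix 4 _≋_
  infixl 7 _⊗_

  _≋_ : Series → Series → Set ℓ
  f ≋ g = ∀ n → f n ≈ g n

  -- The Cauchy product.  It satisfies definitionally
  -- (f ⊗ g) (suc n) = f 0 * g (suc n) + (tail f ⊗ g) n.

  _⊗_ : Series → Series → Series
  (f ⊗ g) n = sum {suc n} λ i → f (toℕ i) * g (n ∸ toℕ i)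

  tail : Series → Series
  tail f n = f (suc n)

  one : Series
  one zero    = 1#
  one (suc _) = 0#

  ⊗-cong : ∀ {f f′ g g′} → f ≋ f′ → g ≋ g′ → f ⊗ g ≋ f′ ⊗ g′
  ⊗-cong f≋f′ g≋g′ n =
    sum-cong-≋ {suc n} λ i → *-cong (f≋f′ (toℕ i)) (g≋g′ (n ∸ toℕ i))

  ⊗-distribʳ : ∀ f g h n → ((λ k → f k + g k) ⊗ h) n ≈ (f ⊗ h) n + (g ⊗ h) n
  ⊗-distribʳ f g h n = ≈-trans
    (sum-cong-≋ {suc n} λ i → distribʳ (h (n ∸ toℕ i)) (f (toℕ i)) (g (toℕ i)))
    (∑-distrib-+ {suc n} (λ i → f (toℕ i) * h (n ∸ toℕ i)) λ i → g (toℕ i) * h (n ∸ toℕ i))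

  ⊗-scaleˡ : ∀ a f g n → ((λ k → a * f k) ⊗ g) n ≈ a * (f ⊗ g) n
  ⊗-scaleˡ a f g n = ≈-sym (≈-trans
    (*-distribˡ-sum {suc n} a (λ i → f (toℕ i) * g (n ∸ toℕ i)))
    (sum-cong-≋ {suc n} λ i → ≈-sym (*-assoc a (f (toℕ i)) (g (n ∸ toℕ i)))))

  ⊗-zeroˡ : ∀ f → (λ _ → 0#) ⊗ f ≋ λ _ → 0#
  ⊗-zeroˡ f zero    = ≈-trans (+-identityʳ _) (zeroˡ (f 0))
  ⊗-zeroˡ f (suc n) = ≈-trans (+-cong (zeroˡ (f (suc n))) (⊗-zeroˡ f n)) (+-identityˡ 0#)

  -- A constant series acts by scaling.

  ⊗-const : ∀ f g → tail f ≋ (λ _ → 0#) → f ⊗ g ≋ λ n → f 0 * g n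
  ⊗-const f g f≋c zero    = +-identityʳ _
  ⊗-const f g f≋c (suc n) = ≈-trans
    (+-congˡ (≈-trans (⊗-cong {g = g} f≋c (λ _ → ≈-refl) n) (⊗-zeroˡ g n)))
    (+-identityʳ _)

  ⊗-identityˡ : ∀ f → one ⊗ f ≋ f
  ⊗-identityˡ f n = ≈-trans (⊗-const one f (λ _ → ≈-refl) n) (*-identityˡ (f n))

  ⊗-assoc : ∀ f g h → (f ⊗ g) ⊗ h ≋ f ⊗ (g ⊗ h)
  ⊗-assoc f g h zero =
    solve 3 (λ a b c → (a :* b :+ con 0) :* c :+ con 0 := a :* (b :* c :+ con 0) :+ con 0)
      ≈-refl (f 0) (g 0) (h 0)
  ⊗-assoc f g h (suc n) = begin
    (f 0 * g 0 + 0#) * h (suc n) + (tail (f ⊗ g) ⊗ h) n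
      ≈⟨ +-congˡ (⊗-distribʳ (λ k → f 0 * tail g k) (tail f ⊗ g) h n) ⟩
    (f 0 * g 0 + 0#) * h (suc n) + (((λ k → f 0 * tail g k) ⊗ h) n + ((tail f ⊗ g) ⊗ h) n)
      ≈⟨ +-congˡ (+-cong (⊗-scaleˡ (f 0) (tail g) h n) (⊗-assoc (tail f) g h n)) ⟩
    (f 0 * g 0 + 0#) * h (suc n) + (f 0 * (tail g ⊗ h) n + (tail f ⊗ (g ⊗ h)) n)
      ≈⟨ solve 5 (λ a b c d e → (a :* b :+ con 0) :* c :+ (a :* d :+ e)
                             := a :* (b :* c :+ d) :+ e)
           ≈-refl (f 0) (g 0) (h (suc n)) ((tail g ⊗ h) n) ((tail f ⊗ (g ⊗ h)) n) ⟩
    f 0 * (g 0 * h (suc n) + (tail g ⊗ h) n) + (tail f ⊗ (g ⊗ h)) n ∎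

  -- The recursion for the product that splits off the last term instead of the first.

  ⊗-sucʳ : ∀ f g n → (f ⊗ g) (suc n) ≈ (f ⊗ tail g) n + f (suc n) * g 0
  ⊗-sucʳ f g zero    = solve 2 (λ a b → a :+ (b :+ con 0) := (a :+ con 0) :+ b)
    ≈-refl (f 0 * g 1) (f 1 * g 0)
  ⊗-sucʳ f g (suc n) = ≈-trans (+-congˡ (⊗-sucʳ (tail f) g n)) (≈-sym (+-assoc _ _ _))

  ⊗-comm : ∀ f g → f ⊗ g ≋ g ⊗ f
  ⊗-comm f g zero    = +-congʳ (*-comm (f 0) (g 0))
  ⊗-comm f g (suc n) = begin
    f 0 * g (suc n) + (tail f ⊗ g) n  ≈⟨ +-cong (*-comm _ _) (⊗-comm (tail f) g n) ⟩
    g (suc n) * f 0 + (g ⊗ tail f) n  ≈⟨ +-comm _ _ ⟩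
    (g ⊗ tail f) n + g (suc n) * f 0  ≈⟨ ⊗-sucʳ g f n ⟨
    (g ⊗ f) (suc n)                   ∎

  seriesRing : CommutativeRing c ℓ
  seriesRing = record
    { isCommutativeRing = record
      { isRing = record
        { +-isAbelianGroup = Pointwise.isAbelianGroup ℕ +-isAbelianGroup
        ; *-cong           = λ {f} {f′} {g} {g′} → ⊗-cong {f} {f′} {g} {g′}
        ; *-assoc          = ⊗-assoc
        ; *-identity       = ⊗-identityˡ ,
            λ f n → ≈-trans (⊗-comm f one n) (⊗-identityˡ f n)
        ; distrib          =
            (λ f g h n → ≈-trans (⊗-comm f (λ k → g k + h k) n)
              (≈-trans (⊗-distribʳ g h f n) (+-cong (⊗-comm g f n) (⊗-comm h f n)))) ,
            λ h f g → ⊗-distribʳ f g h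
        }
      ; *-comm = ⊗-comm
      }
    }

------------------------------------------------------------------------
-- Polynomials in one variable

module Polynomials {c ℓ : Level} (R : CommutativeRing c ℓ) where
  open CommutativeRing R hiding (zero; refl; sym; trans)
  open CommutativeRing R using () renaming (refl to ≈-refl; sym to ≈-sym; trans to ≈-trans)
  open RingProperties ring using (-0#≈0#)
  open FormalSeries R using (Series; _⊗_; ⊗-zeroˡ; seriesRing)

  Poly : Set c
  Poly = List Carrier

  infixl 6 _+ₚ_
  infixl 7 _*ₚ_
  infix 4 _≈ₚ_

  _+ₚ_ _*ₚ_ : Poly → Poly → Poly
  _+ₚ_ = _⊕_ rawRing
  _*ₚ_ = _⊛_ rawRing

  _≈ₚ_ : Poly → Poly → Set ℓ
  p ≈ₚ q = ∀ j → coeff rawRing j p ≈ coeff rawRing j q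

  -- The coefficient sequence.

  series : Poly → Series
  series p j = coeff rawRing j p

  coeff-+ : ∀ p q j → coeff rawRing j (p +ₚ q) ≈ coeff rawRing j p + coeff rawRing j q
  coeff-+ []      q       j       = ≈-sym (+-identityˡ _)
  coeff-+ (a ∷ p) []      j       = ≈-sym (+-identityʳ _)
  coeff-+ (a ∷ p) (b ∷ q) zero    = ≈-refl
  coeff-+ (a ∷ p) (b ∷ q) (suc j) = coeff-+ p q j

  coeff-scale : ∀ a p j → coeff rawRing j (map (a *_) p) ≈ a * coeff rawRing j p
  coeff-scale a []      j       = ≈-sym (zeroʳ a)
  coeff-scale a (b ∷ p) zero    = ≈-refl
  coeff-scale a (b ∷ p) (suc j) = coeff-scale a p j

  coeff-neg : ∀ p j → coeff rawRing j (map (-_) p) ≈ - coeff rawRing j p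
  coeff-neg []      j       = ≈-sym -0#≈0#
  coeff-neg (b ∷ p) zero    = ≈-refl
  coeff-neg (b ∷ p) (suc j) = coeff-neg p j

  coeff-* : ∀ p q j → coeff rawRing j (p *ₚ q) ≈ (series p ⊗ series q) j
  coeff-* []      q j       = ≈-sym (⊗-zeroˡ (series q) j)
  coeff-* (a ∷ p) q zero    = ≈-trans
    (coeff-+ (map (a *_) q) (0# ∷ p *ₚ q) 0)
    (+-congʳ (coeff-scale a q 0))
  coeff-* (a ∷ p) q (suc j) = ≈-trans
    (coeff-+ (map (a *_) q) (0# ∷ p *ₚ q) (suc j))
    (+-cong (coeff-scale a q (suc j)) (coeff-* p q j))

  series-isRingMonomorphism : IsRingMonomorphism (polynomialRawRing rawRing)
                                (CommutativeRing.rawRing seriesRing) series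
  series-isRingMonomorphism = record
    { isRingHomomorphism = record
      { isSemiringHomomorphism = record
        { isNearSemiringHomomorphism = record
          { +-isMonoidHomomorphism = record
            { isMagmaHomomorphism = record
              { isRelHomomorphism = record { cong = λ p≈q → p≈q }
              ; homo              = coeff-+
              }
            ; ε-homo = λ _ → ≈-refl
            }
          ; *-homo = coeff-*
          }
        ; 1#-homo = λ { zero → ≈-refl ; (suc _) → ≈-refl }
        }
      ; -‿homo = coeff-neg
      }
    ; injective = λ p≈q → p≈q
    }

  polynomialRing : CommutativeRing c ℓ
  polynomialRing = record
    { isCommutativeRing = RingMonomorphism.isCommutativeRing series-isRingMonomorphism
        (CommutativeRing.isCommutativeRing seriesRing)
    }

------------------------------------------------------------------------
-- Linear functionals and the derivative on polynomials

module PolynomialCalculus {c ℓ : Level} (R : CommutativeRing c ℓ) where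
  open CommutativeRing R hiding (zero; refl; sym; trans)
  open CommutativeRing R using () renaming (refl to ≈-refl; sym to ≈-sym; trans to ≈-trans)
  open SemiringMult semiring using (_×_; ×-comm-*)
  open CommutativeMonoidMult +-commutativeMonoid using (×-distrib-+)
  open NaturalCoefficients commutativeSemiring using (solve; _:=_; _:+_; _:*_; con)
  open Polynomials R
  private module P = CommutativeRing polynomialRing

  -- functional c p = Σ cᵢ pᵢ  is the R-linear map that sends X ^ i to cᵢ.

  functional : (ℕ → Carrier) → Poly → Carrier
  functional c []      = 0#
  functional c (a ∷ p) = c 0 * a + functional (c ∘ suc) p

  functional-cong : ∀ c p q → p ≈ₚ q → functional c p ≈ functional c q
  functional-cong c []      []      p≈q = ≈-refl
  functional-cong c []      (b ∷ q) p≈q = ≈-sym (≈-trans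
    (+-cong (≈-trans (*-congˡ (≈-sym (p≈q 0))) (zeroʳ (c 0)))
            (≈-sym (functional-cong (c ∘ suc) [] q λ j → p≈q (suc j))))
    (+-identityˡ 0#))
  functional-cong c (a ∷ p) []      p≈q = ≈-trans
    (+-cong (≈-trans (*-congˡ (p≈q 0)) (zeroʳ (c 0)))
            (functional-cong (c ∘ suc) p [] λ j → p≈q (suc j)))
    (+-identityˡ 0#)
  functional-cong c (a ∷ p) (b ∷ q) p≈q =
    +-cong (*-congˡ (p≈q 0)) (functional-cong (c ∘ suc) p q λ j → p≈q (suc j))

  functional-+ : ∀ c p q → functional c (p +ₚ q) ≈ functional c p + functional c q
  functional-+ c []      q       = ≈-sym (+-identityˡ _)
  functional-+ c (a ∷ p) []      = ≈-sym (+-identityʳ _)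
  functional-+ c (a ∷ p) (b ∷ q) = ≈-trans
    (+-congˡ (functional-+ (c ∘ suc) p q))
    (solve 5 (λ c a b x y → c :* (a :+ b) :+ (x :+ y) := c :* a :+ x :+ (c :* b :+ y))
      ≈-refl (c 0) a b _ _)

  functional-scale : ∀ c a p → functional c (map (a *_) p) ≈ a * functional c p
  functional-scale c a []      = ≈-sym (zeroʳ a)
  functional-scale c a (b ∷ p) = ≈-trans
    (+-congˡ (functional-scale (c ∘ suc) a p))
    (solve 4 (λ c a b x → c :* (a :* b) :+ a :* x := a :* (c :* b :+ x)) ≈-refl (c 0) a b _)

  -- Evaluation at 0 and at 1.

  eval₀ eval₁ : Poly → Carrier
  eval₀ = coeff rawRing 0
  eval₁ = functional (λ _ → 1#)

  eval₀-* : ∀ p q → eval₀ (p *ₚ q) ≈ eval₀ p * eval₀ q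
  eval₀-* p q = ≈-trans (coeff-* p q 0) (+-identityʳ _)

  eval₁-* : ∀ p q → eval₁ (p *ₚ q) ≈ eval₁ p * eval₁ q
  eval₁-* []      q = ≈-sym (zeroˡ (eval₁ q))
  eval₁-* (a ∷ p) q = ≈-trans
    (functional-+ _ (map (a *_) q) (0# ∷ p *ₚ q))
    (≈-trans (+-cong (functional-scale _ a q) (+-congˡ (eval₁-* p q)))
      (solve 3 (λ a x y → a :* y :+ (con 1 :* con 0 :+ x :* y) := (con 1 :* a :+ x) :* y)
        ≈-refl a (eval₁ p) (eval₁ q)))

  -- derivFrom k multiplies the coefficient of X ^ i by k + i.

  derivFrom : ℕ → Poly → Poly
  derivFrom k []      = []
  derivFrom k (a ∷ p) = k × a ∷ derivFrom (suc k) p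

  -- The derivative: the constant term is dropped, the coefficient of X ^ (i + 1) is multiplied
  -- by i + 1.

  deriv : Poly → Poly
  deriv []      = []
  deriv (a ∷ p) = derivFrom 1 p

  derivFrom-+ : ∀ k p q → derivFrom k (p +ₚ q) ≈ₚ derivFrom k p +ₚ derivFrom k q
  derivFrom-+ k []      q       j       = ≈-refl
  derivFrom-+ k (a ∷ p) []      j       = ≈-refl
  derivFrom-+ k (a ∷ p) (b ∷ q) zero    = ×-distrib-+ a b k
  derivFrom-+ k (a ∷ p) (b ∷ q) (suc j) = derivFrom-+ (suc k) p q j

  derivFrom-scale : ∀ k a p → derivFrom k (map (a *_) p) ≈ₚ map (a *_) (derivFrom k p)
  derivFrom-scale k a []      j       = ≈-refl
  derivFrom-scale k a (b ∷ p) zero    = ≈-sym (×-comm-* k a b)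
  derivFrom-scale k a (b ∷ p) (suc j) = derivFrom-scale (suc k) a p j

  derivFrom-suc : ∀ k p → derivFrom (suc k) p ≈ₚ p +ₚ derivFrom k p
  derivFrom-suc k []      j       = ≈-refl
  derivFrom-suc k (a ∷ p) zero    = ≈-refl
  derivFrom-suc k (a ∷ p) (suc j) = derivFrom-suc (suc k) p j

  deriv-+ : ∀ p q → deriv (p +ₚ q) ≈ₚ deriv p +ₚ deriv q
  deriv-+ []      q       j = ≈-refl
  deriv-+ (a ∷ p) []      j = ≈-sym (≈-trans (coeff-+ (derivFrom 1 p) [] j) (+-identityʳ _))
  deriv-+ (a ∷ p) (b ∷ q) j = derivFrom-+ 1 p q j

  deriv-scale : ∀ a p → deriv (map (a *_) p) ≈ₚ map (a *_) (deriv p)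
  deriv-scale a []      j = ≈-refl
  deriv-scale a (b ∷ p) j = derivFrom-scale 1 a p j

  -- (X p)′ = p + X p′; as the derivative kills constants, X p may be replaced by b + X p.

  deriv-X* : ∀ b p → deriv (b ∷ p) ≈ₚ p +ₚ (0# ∷ deriv p)
  deriv-X* b []      zero    = ≈-refl
  deriv-X* b []      (suc j) = ≈-refl
  deriv-X* b (a ∷ p) zero    = ≈-refl
  deriv-X* b (a ∷ p) (suc j) = derivFrom-suc 1 p j

  -- 0# ∷ p is X p.

  X*-distribˡ : ∀ {p} q r → p ≈ₚ q +ₚ r → (0# ∷ p) ≈ₚ (0# ∷ q) +ₚ (0# ∷ r)
  X*-distribˡ q r p≈q+r zero    = ≈-sym (+-identityˡ 0#)
  X*-distribˡ q r p≈q+r (suc j) = p≈q+r j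

  X*-assoc : ∀ p q → (0# ∷ p) *ₚ q ≈ₚ (0# ∷ p *ₚ q)
  X*-assoc p q j = ≈-trans (coeff-+ (map (0# *_) q) (0# ∷ p *ₚ q) j)
    (≈-trans (+-congʳ (≈-trans (coeff-scale 0# q j) (zeroˡ _))) (+-identityˡ _))

  deriv-* : ∀ p q → deriv (p *ₚ q) ≈ₚ deriv p *ₚ q +ₚ p *ₚ deriv q
  deriv-* []      q j = ≈-refl
  deriv-* (a ∷ p) q j = begin
    C (deriv (map (a *_) q +ₚ (0# ∷ p *ₚ q)))
      ≈⟨ deriv-+ (map (a *_) q) (0# ∷ p *ₚ q) j ⟩
    C (deriv (map (a *_) q) +ₚ deriv (0# ∷ p *ₚ q))
      ≈⟨ coeff-+ (deriv (map (a *_) q)) (deriv (0# ∷ p *ₚ q)) j ⟩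
    C (deriv (map (a *_) q)) + C (deriv (0# ∷ p *ₚ q))
      ≈⟨ +-cong (deriv-scale a q j)
           (≈-trans (deriv-X* 0# (p *ₚ q) j) (coeff-+ (p *ₚ q) (0# ∷ deriv (p *ₚ q)) j)) ⟩
    C aq′ + (C (p *ₚ q) + C (0# ∷ deriv (p *ₚ q)))
      ≈⟨ +-congˡ (+-congˡ (≈-trans
           (X*-distribˡ {deriv (p *ₚ q)} (deriv p *ₚ q) (p *ₚ deriv q) (deriv-* p q) j)
           (coeff-+ (0# ∷ deriv p *ₚ q) (0# ∷ p *ₚ deriv q) j))) ⟩
    C aq′ + (C (p *ₚ q) + (C (0# ∷ deriv p *ₚ q) + C (0# ∷ p *ₚ deriv q)))
      ≈⟨ solve 4 (λ x y z w → x :+ (y :+ (z :+ w)) := (y :+ z) :+ (x :+ w)) ≈-refl (C aq′) _ _ _ ⟩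
    (C (p *ₚ q) + C (0# ∷ deriv p *ₚ q)) + (C aq′ + C (0# ∷ p *ₚ deriv q))
      ≈⟨ +-cong p′q (≈-sym (coeff-+ aq′ (0# ∷ p *ₚ deriv q) j)) ⟩
    C (deriv (a ∷ p) *ₚ q) + C ((a ∷ p) *ₚ deriv q)
      ≈⟨ coeff-+ (deriv (a ∷ p) *ₚ q) ((a ∷ p) *ₚ deriv q) j ⟨
    C (deriv (a ∷ p) *ₚ q +ₚ (a ∷ p) *ₚ deriv q) ∎
    where
    open ≈-Reasoning setoid
    C : Poly → Carrier
    C = coeff rawRing j
    aq′ : Poly
    aq′ = map (a *_) (deriv q)
    p′q : C (p *ₚ q) + C (0# ∷ deriv p *ₚ q) ≈ C (deriv (a ∷ p) *ₚ q)
    p′q = begin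
      C (p *ₚ q) + C (0# ∷ deriv p *ₚ q)    ≈⟨ +-congˡ (X*-assoc (deriv p) q j) ⟨
      C (p *ₚ q) + C ((0# ∷ deriv p) *ₚ q)  ≈⟨ coeff-+ (p *ₚ q) ((0# ∷ deriv p) *ₚ q) j ⟨
      C (p *ₚ q +ₚ (0# ∷ deriv p) *ₚ q)     ≈⟨ P.distribʳ q p (0# ∷ deriv p) j ⟨
      C ((p +ₚ (0# ∷ deriv p)) *ₚ q)
        ≈⟨ P.*-congʳ {q} {deriv (a ∷ p)} {p +ₚ (0# ∷ deriv p)} (deriv-X* a p) j ⟨
      C (deriv (a ∷ p) *ₚ q)                ∎

  -- The fundamental theorem of calculus, p(0) + ∫₀¹ p′ = p(1).  The integral is the functional
  -- whose coefficients rᵢ invert i + 1.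

  functional-derivFrom : ∀ r k → (∀ i a → r i * ((i ℕ.+ k) × a) ≈ a) →
                         ∀ p → functional r (derivFrom k p) ≈ eval₁ p
  functional-derivFrom r k r-inverse []      = ≈-refl
  functional-derivFrom r k r-inverse (a ∷ p) = +-cong
    (≈-trans (r-inverse 0 a) (≈-sym (*-identityˡ a)))
    (functional-derivFrom (r ∘ suc) (suc k) r-inverse′ p)
    where
    r-inverse′ : ∀ i a → r (suc i) * ((i ℕ.+ suc k) × a) ≈ a
    r-inverse′ i a = subst (λ m → r (suc i) * (m × a) ≈ a) (sym (ℕₚ.+-suc i k)) (r-inverse (suc i) a)

  functional-deriv : ∀ r → (∀ i a → r i * (suc i × a) ≈ a) →
                     ∀ p → eval₀ p + functional r (deriv p) ≈ eval₁ p
  functional-deriv r r-inverse []      = +-identityˡ 0#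
  functional-deriv r r-inverse (a ∷ p) = +-cong (≈-sym (*-identityˡ a))
    (functional-derivFrom r 1
      (λ i a → subst (λ m → r i * (m × a) ≈ a) (ℕₚ.+-comm 1 i) (r-inverse i a)) p)

------------------------------------------------------------------------
-- Weights of multi-indices

-- weighted c α = Σ cᵢ αᵢ

weighted : ∀ {n} → (Fin n → ℕ) → MultiIndex n → ℕ
weighted c []      = 0
weighted c (a ∷ α) = c zero ℕ.* a ℕ.+ weighted (c ∘ suc) α

-- The total degree |α|.

total : ∀ {n} → MultiIndex n → ℕ
total = weighted (λ _ → 1)

weighted-cong : ∀ {n} {c c′ : Fin n → ℕ} → (∀ i → c i ≡ c′ i) → ∀ α → weighted c α ≡ weighted c′ α
weighted-cong c≡c′ []      = refl
weighted-cong c≡c′ (a ∷ α) = cong₂ ℕ._+_ (cong (ℕ._* a) (c≡c′ zero)) (weighted-cong (c≡c′ ∘ suc) α)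

weighted-+ : ∀ {n} (c : Fin n → ℕ) j α →
             weighted (λ i → c i ℕ.+ j) α ≡ weighted c α ℕ.+ j ℕ.* total α
weighted-+ c j []      = sym (ℕₚ.*-zeroʳ j)
weighted-+ c j (a ∷ α) = trans
  (cong ((c zero ℕ.+ j) ℕ.* a ℕ.+_) (weighted-+ (c ∘ suc) j α))
  (regroup (c zero) j a (weighted (c ∘ suc) α) (total α))
  where
  regroup : ∀ c j a w s → (c ℕ.+ j) ℕ.* a ℕ.+ (w ℕ.+ j ℕ.* s) ≡ c ℕ.* a ℕ.+ w ℕ.+ j ℕ.* (1 ℕ.* a ℕ.+ s)
  regroup = ℕ-Solver.solve-∀

weighted-replicate-0 : ∀ {n} (c : Fin n → ℕ) → weighted c (replicate n 0) ≡ 0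
weighted-replicate-0 {zero}  c = refl
weighted-replicate-0 {suc n} c = cong₂ ℕ._+_ (ℕₚ.*-zeroʳ (c zero)) (weighted-replicate-0 (c ∘ suc))

total≡0⇒≡0 : ∀ {n} (α : MultiIndex n) → total α ≡ 0 → α ≡ replicate n 0
total≡0⇒≡0 []         _  = refl
total≡0⇒≡0 (zero ∷ α) eq = cong (0 ∷_) (total≡0⇒≡0 α eq)

weighted-updateAt : ∀ {n} (c : Fin n → ℕ) i β →
                    weighted c (updateAt β i suc) ≡ c i ℕ.+ weighted c β
weighted-updateAt c zero    (b ∷ β) = regroup (c zero) b (weighted (c ∘ suc) β)
  where
  regroup : ∀ c b w → c ℕ.* suc b ℕ.+ w ≡ c ℕ.+ (c ℕ.* b ℕ.+ w)
  regroup = ℕ-Solver.solve-∀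
weighted-updateAt c (suc i) (b ∷ β) = trans
  (cong (c zero ℕ.* b ℕ.+_) (weighted-updateAt (c ∘ suc) i β))
  (regroup (c zero ℕ.* b) (c (suc i)) (weighted (c ∘ suc) β))
  where
  regroup : ∀ x y z → x ℕ.+ (y ℕ.+ z) ≡ y ℕ.+ (x ℕ.+ z)
  regroup = ℕ-Solver.solve-∀

------------------------------------------------------------------------
-- Products of powers

module PowerProducts {c ℓ : Level} (R : CommutativeRing c ℓ) where
  open CommutativeRing R hiding (zero; refl; sym; trans)
  open CommutativeRing R using () renaming (refl to ≈-refl; sym to ≈-sym; trans to ≈-trans)
  open SemiringMult semiring using (_×_; ×-comm-*)
  open SemiringExp semiring using (_^_; ^-congˡ; ^-homo-*; ^-assocʳ)
  open CommutativeSemiringExp commutativeSemiring using (^-distrib-*)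
  open RawSemiringDefs (RawRing.rawSemiring rawRing) using (product)
  open NaturalCoefficients commutativeSemiring using (solve; _:=_; _:+_; _:*_; con)
  open ≈-Reasoning setoid

  infix 8 _^^_

  -- y ^^ α = Π yᵢ ^ αᵢ

  _^^_ : ∀ {n} → (Fin n → Carrier) → MultiIndex n → Carrier
  y ^^ []      = 1#
  y ^^ (a ∷ α) = y zero ^ a * (y ∘ suc) ^^ α

  ^^-cong : ∀ {n} {x y : Fin n → Carrier} → (∀ i → x i ≈ y i) → ∀ α → x ^^ α ≈ y ^^ α
  ^^-cong x≈y []      = ≈-refl
  ^^-cong x≈y (a ∷ α) = *-cong (^-congˡ a (x≈y zero)) (^^-cong (x≈y ∘ suc) α)

  ^^-distrib-* : ∀ {n} (x y : Fin n → Carrier) α → (λ i → x i * y i) ^^ α ≈ x ^^ α * y ^^ α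
  ^^-distrib-* x y []      = ≈-sym (*-identityˡ 1#)
  ^^-distrib-* x y (a ∷ α) = ≈-trans
    (*-cong (^-distrib-* (x zero) (y zero) a) (^^-distrib-* (x ∘ suc) (y ∘ suc) α))
    (solve 4 (λ a b c d → (a :* b) :* (c :* d) := (a :* c) :* (b :* d)) ≈-refl _ _ _ _)

  ^^-weighted : ∀ {n} u (k : Fin n → ℕ) α → (λ i → u ^ k i) ^^ α ≈ u ^ weighted k α
  ^^-weighted u k []      = ≈-refl
  ^^-weighted u k (a ∷ α) = ≈-trans
    (*-cong (^-assocʳ u (k zero) a) (^^-weighted u (k ∘ suc) α))
    (≈-sym (^-homo-* u (k zero ℕ.* a) _))

  ^^-replicate : ∀ {n} (y : Fin n → Carrier) m → y ^^ replicate n m ≈ product y ^ m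
  ^^-replicate {zero}  y m = 1≈1^ m
    where
    1≈1^ : ∀ m → 1# ≈ 1# ^ m
    1≈1^ zero    = ≈-refl
    1≈1^ (suc m) = ≈-trans (1≈1^ m) (≈-sym (*-identityˡ _))
  ^^-replicate {suc n} y m = ≈-trans
    (*-congˡ (^^-replicate (y ∘ suc) m))
    (≈-sym (^-distrib-* (y zero) (product (y ∘ suc)) m))

  -- With the yᵢ as indeterminates: powerDeriv is d/dy of y ^ a, and Σ∂ y α = Σᵢ ∂(y ^^ α)/∂yᵢ.

  powerDeriv : Carrier → ℕ → Carrier
  powerDeriv y zero    = 0#
  powerDeriv y (suc a) = suc a × y ^ a

  Σ∂ : ∀ {n} → (Fin n → Carrier) → MultiIndex n → Carrier
  Σ∂ y []      = 0#
  Σ∂ y (a ∷ α) = powerDeriv (y zero) a * (y ∘ suc) ^^ α + y zero ^ a * Σ∂ (y ∘ suc) α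

  -- A derivation with yᵢ ↦ -1 for all i sends y ^^ α to - Σ∂ y α.

  module Derivation
    (D : Carrier → Carrier)
    (D-1 : D 1# ≈ 0#)
    (D-* : ∀ p q → D (p * q) ≈ D p * q + p * D q)
    where

    D-power : ∀ y → D y + 1# ≈ 0# → ∀ a → powerDeriv y a + D (y ^ a) ≈ 0#
    D-power y Dy zero    = ≈-trans (+-identityˡ _) D-1
    D-power y Dy (suc a) = begin
      (y ^ a + a × y ^ a) + D (y * y ^ a)
        ≈⟨ +-cong (+-congˡ (×-^ a)) (D-* y (y ^ a)) ⟩
      (y ^ a + y * powerDeriv y a) + (D y * y ^ a + y * D (y ^ a))
        ≈⟨ solve 5 (λ x y w d e → (x :+ y :* w) :+ (d :* x :+ y :* e)
                               := (d :+ con 1) :* x :+ y :* (w :+ e))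
             ≈-refl (y ^ a) y (powerDeriv y a) (D y) (D (y ^ a)) ⟩
      (D y + 1#) * y ^ a + y * (powerDeriv y a + D (y ^ a))
        ≈⟨ +-cong (*-congʳ Dy) (*-congˡ (D-power y Dy a)) ⟩
      0# * y ^ a + y * 0#
        ≈⟨ +-cong (zeroˡ (y ^ a)) (zeroʳ y) ⟩
      0# + 0#
        ≈⟨ +-identityˡ 0# ⟩
      0# ∎
      where
      ×-^ : ∀ a → a × y ^ a ≈ y * powerDeriv y a
      ×-^ zero    = ≈-sym (zeroʳ y)
      ×-^ (suc a) = ≈-sym (×-comm-* (suc a) y (y ^ a))

    D-^^ : ∀ {n} (y : Fin n → Carrier) → (∀ i → D (y i) + 1# ≈ 0#) →
           ∀ α → Σ∂ y α + D (y ^^ α) ≈ 0#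
    D-^^ y Dy []      = ≈-trans (+-identityˡ _) D-1
    D-^^ y Dy (a ∷ α) = begin
      (powerDeriv y₀ a * Y + y₀ ^ a * Σ∂ (y ∘ suc) α) + D (y₀ ^ a * Y)
        ≈⟨ +-congˡ (D-* (y₀ ^ a) Y) ⟩
      (powerDeriv y₀ a * Y + y₀ ^ a * Σ∂ (y ∘ suc) α) + (D (y₀ ^ a) * Y + y₀ ^ a * D Y)
        ≈⟨ solve 6 (λ p u x s d e → (p :* u :+ x :* s) :+ (d :* u :+ x :* e)
                                 := (p :+ d) :* u :+ x :* (s :+ e))
             ≈-refl (powerDeriv y₀ a) Y (y₀ ^ a) (Σ∂ (y ∘ suc) α) (D (y₀ ^ a)) (D Y) ⟩
      (powerDeriv y₀ a + D (y₀ ^ a)) * Y + y₀ ^ a * (Σ∂ (y ∘ suc) α + D Y)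
        ≈⟨ +-cong (*-congʳ (D-power y₀ (Dy zero) a)) (*-congˡ (D-^^ (y ∘ suc) (Dy ∘ suc) α)) ⟩
      0# * Y + y₀ ^ a * 0#
        ≈⟨ +-cong (zeroˡ Y) (zeroʳ (y₀ ^ a)) ⟩
      0# + 0#
        ≈⟨ +-identityˡ 0# ⟩
      0# ∎
      where
      y₀ Y : Carrier
      y₀ = y zero
      Y  = (y ∘ suc) ^^ α

-- Multiplicative maps commute with products of powers.

module _ {c ℓ c′ ℓ′ : Level} (R : CommutativeRing c ℓ) (R′ : CommutativeRing c′ ℓ′)
  (e : CommutativeRing.Carrier R → CommutativeRing.Carrier R′) where
  private
    module R  = CommutativeRing R
    module R′ = CommutativeRing R′
  open PowerProducts R using (_^^_)
  open PowerProducts R′ using () renaming (_^^_ to _^^′_)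
  open SemiringExp R.semiring using (_^_)
  open SemiringExp R′.semiring using () renaming (_^_ to _^′_)

  ^^-homo : e R.1# R′.≈ R′.1# → (∀ p q → e (p R.* q) R′.≈ e p R′.* e q) →
            ∀ {n} (y : Fin n → R.Carrier) α → e (y ^^ α) R′.≈ (e ∘ y) ^^′ α
  ^^-homo e-1 e-* y []      = e-1
  ^^-homo e-1 e-* y (a ∷ α) = R′.trans (e-* _ _)
    (R′.*-cong (^-homo a) (^^-homo e-1 e-* (y ∘ suc) α))
    where
    ^-homo : ∀ a → e (y zero ^ a) R′.≈ e (y zero) ^′ a
    ^-homo zero    = e-1
    ^-homo (suc a) = R′.trans (e-* _ _) (R′.*-congˡ (^-homo a))

------------------------------------------------------------------------
-- Identities in a commutative ring

-- If s = 1 + Σ xᵢ s ^ kᵢ then s ^ (j + 1) = s ^ j + Σ xᵢ s ^ (kᵢ + j).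

module _ {c ℓ : Level} (R : CommutativeRing c ℓ) where
  open CommutativeRing R hiding (zero; refl; sym; trans)
  open CommutativeRing R using () renaming (sym to ≈-sym; trans to ≈-trans)
  open SemiringSum semiring using (sum; sum-cong-≋; *-distribʳ-sum)
  open SemiringExp semiring using (_^_; ^-homo-*)
  open ≈-Reasoning setoid

  power-step : ∀ {n} (x : Fin n → Carrier) (k : Fin n → ℕ) s →
               s ≈ 1# + sum (λ i → x i * s ^ k i) →
               ∀ j → s ^ suc j ≈ s ^ j + sum (λ i → x i * s ^ (k i ℕ.+ j))
  power-step x k s eq j = begin
    s * s ^ j
      ≈⟨ *-congʳ eq ⟩
    (1# + sum (λ i → x i * s ^ k i)) * s ^ j
      ≈⟨ distribʳ (s ^ j) 1# (sum (λ i → x i * s ^ k i)) ⟩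
    1# * s ^ j + sum (λ i → x i * s ^ k i) * s ^ j
      ≈⟨ +-cong (*-identityˡ (s ^ j)) (*-distribʳ-sum (s ^ j) (λ i → x i * s ^ k i)) ⟩
    s ^ j + sum (λ i → (x i * s ^ k i) * s ^ j)
      ≈⟨ +-congˡ (sum-cong-≋ λ i → ≈-trans (*-assoc (x i) (s ^ k i) (s ^ j))
           (*-congˡ (≈-sym (^-homo-* s (k i) j)))) ⟩
    s ^ j + sum (λ i → x i * s ^ (k i ℕ.+ j)) ∎

module _ {c ℓ : Level} (R : CommutativeRing c ℓ) where
  open CommutativeRing R hiding (zero; refl; sym; trans)
  open CommutativeRing R using () renaming (refl to ≈-refl; sym to ≈-sym; trans to ≈-trans)
  open SemiringExp semiring using (_^_; ^-homo-*)
  open NaturalCoefficients commutativeSemiring using (solve; _:=_; _:+_; _:*_; con)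

  -- geometric u k = 1 + u + ⋯ + u ^ (k - 1)

  geometric : Carrier → ℕ → Carrier
  geometric u zero    = 0#
  geometric u (suc k) = geometric u k + u ^ k

  geometric-sum : ∀ u z → u ≈ 1# + z → ∀ k → u ^ k ≈ 1# + z * geometric u k
  geometric-sum u z u≈1+z zero    = ≈-sym (≈-trans (+-congˡ (zeroʳ z)) (+-identityʳ 1#))
  geometric-sum u z u≈1+z (suc k) = ≈-trans (*-congʳ u≈1+z) (≈-trans
    (solve 2 (λ z x → (con 1 :+ z) :* x := x :+ z :* x) ≈-refl z (u ^ k))
    (≈-trans (+-congʳ (geometric-sum u z u≈1+z k))
      (solve 3 (λ z g x → con 1 :+ z :* g :+ z :* x := con 1 :+ z :* (g :+ x))
        ≈-refl z (geometric u k) (u ^ k))))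

  -- The left-hand side is u ^ k - 1 in the form in which evaluating the list of coefficients of
  -- u ^ k - x at x = 1 produces it.

  power-minus-1 : ∀ u z → u ≈ 1# + z → ∀ k →
                  1# * (u ^ k + 0#) + (1# * (- 1#) + 0#) ≈ z * geometric u k
  power-minus-1 u z u≈1+z k = ≈-trans
    (solve 2 (λ x m → con 1 :* (x :+ con 0) :+ (con 1 :* m :+ con 0) := x :+ m) ≈-refl (u ^ k) (- 1#))
    (≈-trans (+-congʳ (geometric-sum u z u≈1+z k))
    (≈-trans (solve 3 (λ m y o → o :+ y :+ m := y :+ (o :+ m)) ≈-refl (- 1#) (z * geometric u k) 1#)
    (≈-trans (+-congˡ (-‿inverseʳ 1#)) (+-identityʳ _))))

  -- To be used with a = - ∫ p′, d = ∫ p′, e₀ = p(0) and e₁ = p(1): if p(0) = u ^ w, then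
  -- u ^ E a = u ^ (E + w) - u ^ E e₁, where e₁ is a multiple of y.

  endpoints : ∀ {a d e₀ e₁} u w E {y v} → a + d ≈ 0# → e₀ + d ≈ e₁ → e₀ ≈ u ^ w → e₁ ≈ y * v →
              u ^ E * a + y * (v * u ^ E) ≈ u ^ (E ℕ.+ w)
  endpoints {a} {d} {e₀} {e₁} u w E {y} {v} a+d≈0 e₀+d≈e₁ e₀≈u^w e₁≈yv = begin
    u ^ E * a + y * (v * u ^ E)
      ≈⟨ solve 4 (λ x a y v → x :* a :+ y :* (v :* x) := x :* (a :+ y :* v)) ≈-refl (u ^ E) a y v ⟩
    u ^ E * (a + y * v)
      ≈⟨ *-congˡ (+-congˡ (≈-trans (≈-sym e₁≈yv) (≈-sym e₀+d≈e₁))) ⟩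
    u ^ E * (a + (e₀ + d))
      ≈⟨ *-congˡ (solve 3 (λ a e d → a :+ (e :+ d) := e :+ (a :+ d)) ≈-refl a e₀ d) ⟩
    u ^ E * (e₀ + (a + d))
      ≈⟨ *-congˡ (≈-trans (+-congˡ a+d≈0) (+-identityʳ e₀)) ⟩
    u ^ E * e₀
      ≈⟨ *-congˡ e₀≈u^w ⟩
    u ^ E * u ^ w
      ≈⟨ ^-homo-* u E w ⟨
    u ^ (E ℕ.+ w) ∎
    where open ≈-Reasoning setoid

------------------------------------------------------------------------
-- The ring of formal power series in several variables

-- The coefficients of a power series in suc n variables, read as a series in the first
-- variable over the power series in the others.

firstVariable : ∀ {n} → PowerSeries (suc n) → ℕ → PowerSeries n
firstVariable f a α = f (a ∷ α)

sumℚ : ∀ {k} → (Fin k → ℚ) → ℚ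
sumℚ = RawMonoidDefs.sum ℚ.+-0-rawMonoid

sumₛ : ∀ n {k} → (Fin k → PowerSeries n) → PowerSeries n
sumₛ n = RawMonoidDefs.sum (RawRing.+-rawMonoid (powerSeriesRawRing n))

-- Sums of power series are computed coefficientwise.

sum-eval : ∀ {n k} (F : Fin k → PowerSeries n) α →
           sumₛ n F α ≡ sumℚ (λ i → F i α)
sum-eval {k = zero}  F α = refl
sum-eval {k = suc k} F α = cong (F zero α ℚ.+_) (sum-eval (F ∘ suc) α)

IsPowerSeriesRing : ℕ → Set
IsPowerSeriesRing n = IsCommutativeRing _≈_ _+_ _*_ -_ 0# 1#
  where open RawRing (powerSeriesRawRing n)

constantTerm-isRingMonomorphism : IsRingMonomorphism (powerSeriesRawRing 0) ℚ.+-*-rawRing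
                                    (λ f → f [])
constantTerm-isRingMonomorphism = record
  { isRingHomomorphism = record
    { isSemiringHomomorphism = record
      { isNearSemiringHomomorphism = record
        { +-isMonoidHomomorphism = record
          { isMagmaHomomorphism = record
            { isRelHomomorphism = record { cong = λ f≈g → f≈g [] }
            ; homo              = λ _ _ → refl
            }
          ; ε-homo = refl
          }
        ; *-homo = λ _ _ → refl
        }
      ; 1#-homo = refl
      }
    ; -‿homo = λ _ → refl
    }
  ; injective = λ { eq [] → eq }
  }

-- The ring laws come by induction on the number of variables, along firstVariable.

module _ {n : ℕ} (isRing : IsPowerSeriesRing n) where

  private
    coefficients : CommutativeRing 0ℓ 0ℓ
    coefficients = record { isCommutativeRing = isRing }

  open FormalSeries coefficients using (seriesRing)

  firstVariable-isRingMonomorphism : IsRingMonomorphism (powerSeriesRawRing (suc n))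
                                       (CommutativeRing.rawRing seriesRing) firstVariable
  firstVariable-isRingMonomorphism = record
    { isRingHomomorphism = record
      { isSemiringHomomorphism = record
        { isNearSemiringHomomorphism = record
          { +-isMonoidHomomorphism = record
            { isMagmaHomomorphism = record
              { isRelHomomorphism = record { cong = λ f≈g a α → f≈g (a ∷ α) }
              ; homo              = λ _ _ _ _ → refl
              }
            ; ε-homo = λ _ _ → refl
            }
          ; *-homo = λ f g a α → sym (sum-eval {n} {suc a}
              (λ i → firstVariable f (toℕ i) * firstVariable g (a ∸ toℕ i)) α)
          }
        ; 1#-homo = λ { zero _ → refl ; (suc _) _ → refl }
        }
      ; -‿homo = λ _ _ _ → refl
      }
    ; injective = λ { f≈g (a ∷ α) → f≈g a α }
    }
    where open RawRing (powerSeriesRawRing n) using (_*_)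

  isPowerSeriesRing-suc : IsPowerSeriesRing (suc n)
  isPowerSeriesRing-suc = RingMonomorphism.isCommutativeRing firstVariable-isRingMonomorphism
    (CommutativeRing.isCommutativeRing seriesRing)

isPowerSeriesRing : ∀ n → IsPowerSeriesRing n
isPowerSeriesRing zero    = RingMonomorphism.isCommutativeRing constantTerm-isRingMonomorphism
                              ℚₚ.+-*-isCommutativeRing
isPowerSeriesRing (suc n) = isPowerSeriesRing-suc (isPowerSeriesRing n)

powerSeriesRing : ℕ → CommutativeRing 0ℓ 0ℓ
powerSeriesRing n = record { isCommutativeRing = isPowerSeriesRing n }

------------------------------------------------------------------------
-- Multiplication by a variable

open ≡-Reasoning
open SemiringSum (CommutativeRing.semiring ℚₚ.+-*-commutativeRing)
  using (sum-cong-≗; *-distribˡ-sum; sum-replicate-zero)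

-- shift i f α = f (α - eᵢ), read as 0 when αᵢ = 0.

shift : ∀ {n} → Fin n → PowerSeries n → PowerSeries n
shift zero    f (zero  ∷ α) = 0ℚ
shift zero    f (suc a ∷ α) = f (a ∷ α)
shift (suc i) f (a     ∷ α) = shift i (firstVariable f a) α

-- Multiplication by tᵢ is the shift by eᵢ.

t-* : ∀ {n} (i : Fin n) f α → (RawRing._*_ (powerSeriesRawRing n) (t n i) f) α ≡ shift i f α
t-* {suc n} i f (a ∷ α) = trans
  (sym (sum-eval {n} {suc a} (λ b → T i (toℕ b) * F (a ∸ toℕ b)) α))
  (T⊗F i a)
  where
  open CommutativeRing (powerSeriesRing n) using (_*_; +-identityʳ; zeroˡ)
  open FormalSeries (powerSeriesRing n)
  T : Fin (suc n) → Series
  T i = firstVariable (t (suc n) i)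

  F : Series
  F = firstVariable f

  tail-T₀ : tail (T zero) ≋ one
  tail-T₀ zero    _ = refl
  tail-T₀ (suc _) _ = refl

  T⊗F : ∀ i a → (T i ⊗ F) a α ≡ shift i f (a ∷ α)
  T⊗F zero    zero    = trans (+-identityʳ (T zero 0 * F 0) α) (zeroˡ (F 0) α)
  T⊗F zero    (suc a) = begin
    (T zero 0 * F (suc a)) α ℚ.+ (tail (T zero) ⊗ F) a α
      ≡⟨ cong₂ ℚ._+_ (zeroˡ (F (suc a)) α)
           (⊗-cong {tail (T zero)} {one} {F} {F} tail-T₀ (λ _ _ → refl) a α) ⟩
    0ℚ ℚ.+ (one ⊗ F) a α
      ≡⟨ ℚₚ.+-identityˡ ((one ⊗ F) a α) ⟩
    (one ⊗ F) a α
      ≡⟨ ⊗-identityˡ F a α ⟩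
    f (a ∷ α) ∎
  T⊗F (suc i) a = trans (⊗-const (T (suc i)) F (λ _ _ → refl) a α) (t-* i (F a) α)

module _ {D : ℕ} where
  open RawRing (powerSeriesRawRing D) using (_*_; rawSemiring)
  open RawSemiringDefs rawSemiring using (_^_)

  Σt-* : (F : Fin D → PowerSeries D) → ∀ α →
         sumₛ D (λ i → t D i * F i) α ≡ sumℚ (λ i → shift i (F i) α)
  Σt-* F α = trans (sum-eval (λ i → t D i * F i) α) (sum-cong-≗ λ i → t-* i (F i) α)

  hyperCatalan-power-step : ∀ {S} → IsHyperCatalan D S → ∀ j α →
    (S ^ suc j) α ≡ (S ^ j) α ℚ.+ sumℚ (λ i → shift i (S ^ (2 ℕ.+ toℕ i ℕ.+ j)) α)
  hyperCatalan-power-step {S} isHC j α = trans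
    (power-step (powerSeriesRing D) (t D) (λ i → 2 ℕ.+ toℕ i) S isHC j α)
    (cong ((S ^ j) α ℚ.+_) (Σt-* (λ i → S ^ (2 ℕ.+ toℕ i ℕ.+ j)) α))

  geode-step : ∀ {S G} → IsGeode D S G → ∀ α →
    S α ℚ.- RawRing.1# (powerSeriesRawRing D) α ≡ sumℚ (λ i → shift i G α)
  geode-step {S} {G} isGeode α = begin
    S α ℚ.- RawRing.1# (powerSeriesRawRing D) α  ≡⟨ isGeode α ⟩
    (sumₛ D (t D) * G) α                         ≡⟨ *-distribʳ-sum G (t D) α ⟩
    sumₛ D (λ i → t D i * G) α                   ≡⟨ Σt-* (λ _ → G) α ⟩
    sumℚ (λ i → shift i G α)                     ∎
    where open SemiringSum (CommutativeRing.semiring (powerSeriesRing D)) using (*-distribʳ-sum)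

------------------------------------------------------------------------
-- Shifts of power series

-- The only value of f that shift i f α depends on is f β with β + eᵢ = α.

shift-cong : ∀ {n} i {f g : PowerSeries n} α →
             (∀ β → updateAt β i suc ≡ α → f β ≡ g β) → shift i f α ≡ shift i g α
shift-cong zero    (zero  ∷ α) f≡g = refl
shift-cong zero    (suc a ∷ α) f≡g = f≡g (a ∷ α) refl
shift-cong (suc i) (a ∷ α)     f≡g = shift-cong i α λ β eq → f≡g (a ∷ β) (cong (a ∷_) eq)

shift-scale : ∀ {n} i x (f : PowerSeries n) α → shift i (λ β → x ℚ.* f β) α ≡ x ℚ.* shift i f α
shift-scale zero    x f (zero  ∷ α) = sym (ℚₚ.*-zeroʳ x)
shift-scale zero    x f (suc a ∷ α) = refl
shift-scale (suc i) x f (a ∷ α)     = shift-scale i x (firstVariable f a) α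

shift-replicate-0 : ∀ {n} i (f : PowerSeries n) → shift i f (replicate n 0) ≡ 0ℚ
shift-replicate-0 zero    f = refl
shift-replicate-0 (suc i) f = shift-replicate-0 i (firstVariable f 0)

------------------------------------------------------------------------
-- Natural numbers and factorials in ℚ

open SemiringMult (CommutativeRing.semiring ℚₚ.+-*-commutativeRing)
  using (×-homo-+; ×1-homo-*) renaming (_×_ to _×ℚ_)
open CommutativeSemigroupProperties
  (CommutativeMonoid.commutativeSemigroup ℚₚ.*-1-commutativeMonoid)
  using (interchange; x∙yz≈y∙xz)

-- The embedding of ℕ into ℚ, as multiples of 1.

ι : ℕ → ℚ
ι n = n ×ℚ 1ℚ

ι-+ : ∀ m n → ι (m ℕ.+ n) ≡ ι m ℚ.+ ι n
ι-+ = ×-homo-+ 1ℚ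

ι-* : ∀ m n → ι (m ℕ.* n) ≡ ι m ℚ.* ι n
ι-* = ×1-homo-*

toℚᵘ-ι : ∀ n → toℚᵘ (ι n) ≃ mkℚᵘ (+ n) 0
toℚᵘ-ι zero    = ℚᵘₚ.≃-refl
toℚᵘ-ι (suc n) = ℚᵘₚ.≃-trans (ℚₚ.toℚᵘ-homo-+ 1ℚ (ι n))
  (ℚᵘₚ.≃-trans (ℚᵘₚ.+-congʳ (mkℚᵘ (+ 1) 0) (toℚᵘ-ι n))
    (*≡* (cong (λ k → (+ 1 ℤ.+ k) ℤ.* + 1) (ℤₚ.*-identityʳ (+ n)))))

-- n · (m / n) = m

ι-*-/ : ∀ m n .{{_ : NonZero n}} → ι n ℚ.* (+ m ℚ./ n) ≡ ι m
ι-*-/ m (suc n) = ℚₚ.toℚᵘ-injective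
  (ℚᵘₚ.≃-trans (ℚₚ.toℚᵘ-homo-* (ι (suc n)) (+ m ℚ./ suc n))
  (ℚᵘₚ.≃-trans (ℚᵘₚ.*-cong (toℚᵘ-ι (suc n)) (ℚₚ.toℚᵘ-fromℚᵘ (mkℚᵘ (+ m) n)))
  (ℚᵘₚ.≃-trans (*≡* eq) (ℚᵘₚ.≃-sym (toℚᵘ-ι m)))))
  where
  eq : (+ suc n ℤ.* + m) ℤ.* + 1 ≡ + m ℤ.* (+ suc (n ℕ.+ 0))
  eq = trans (ℤₚ.*-identityʳ _) (trans (ℤₚ.*-comm (+ suc n) (+ m))
         (cong (λ k → + m ℤ.* + suc k) (sym (ℕₚ.+-identityʳ n))))

-- recip n = 1 / (n + 1).

recip : ℕ → ℚ
recip n = + 1 ℚ./ suc n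

ι-*-recip : ∀ n → ι (suc n) ℚ.* recip n ≡ 1ℚ
ι-*-recip n = ι-*-/ 1 (suc n)

ι-cancel : ∀ n .{{_ : NonZero n}} {x y} → ι n ℚ.* x ≡ ι n ℚ.* y → x ≡ y
ι-cancel (suc n) {x} {y} eq = begin
  x                               ≡⟨ expand x ⟩
  recip n ℚ.* (ι (suc n) ℚ.* x)   ≡⟨ cong (recip n ℚ.*_) eq ⟩
  recip n ℚ.* (ι (suc n) ℚ.* y)   ≡⟨ expand y ⟨
  y                               ∎
  where
  expand : ∀ z → z ≡ recip n ℚ.* (ι (suc n) ℚ.* z)
  expand z = begin
    z                                ≡⟨ ℚₚ.*-identityˡ z ⟨
    1ℚ ℚ.* z                         ≡⟨ cong (ℚ._* z) (ι-*-recip n) ⟨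
    (ι (suc n) ℚ.* recip n) ℚ.* z    ≡⟨ cong (ℚ._* z) (ℚₚ.*-comm (ι (suc n)) (recip n)) ⟩
    (recip n ℚ.* ι (suc n)) ℚ.* z    ≡⟨ ℚₚ.*-assoc (recip n) (ι (suc n)) z ⟩
    recip n ℚ.* (ι (suc n) ℚ.* z)    ∎

-- 1 / n!

1/_! : ℕ → ℚ
1/ zero  ! = 1ℚ
1/ suc n ! = recip n ℚ.* 1/ n !

ι-*-1/! : ∀ n → ι (suc n) ℚ.* 1/ suc n ! ≡ 1/ n !
ι-*-1/! n = begin
  ι (suc n) ℚ.* (recip n ℚ.* 1/ n !)  ≡⟨ ℚₚ.*-assoc (ι (suc n)) (recip n) 1/ n ! ⟨
  ι (suc n) ℚ.* recip n ℚ.* 1/ n !    ≡⟨ cong (ℚ._* 1/ n !) (ι-*-recip n) ⟩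
  1ℚ ℚ.* 1/ n !                       ≡⟨ ℚₚ.*-identityˡ 1/ n ! ⟩
  1/ n !                              ∎

ι-!-*-1/! : ∀ n → ι (n !) ℚ.* 1/ n ! ≡ 1ℚ
ι-!-*-1/! zero    = refl
ι-!-*-1/! (suc n) = begin
  ι (suc n ℕ.* n !) ℚ.* 1/ suc n !
    ≡⟨ cong (ℚ._* 1/ suc n !) (trans (cong ι (ℕₚ.*-comm (suc n) (n !))) (ι-* (n !) (suc n))) ⟩
  ι (n !) ℚ.* ι (suc n) ℚ.* 1/ suc n !
    ≡⟨ ℚₚ.*-assoc (ι (n !)) (ι (suc n)) _ ⟩
  ι (n !) ℚ.* (ι (suc n) ℚ.* 1/ suc n !)
    ≡⟨ cong (ι (n !) ℚ.*_) (ι-*-1/! n) ⟩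
  ι (n !) ℚ.* 1/ n !
    ≡⟨ ι-!-*-1/! n ⟩
  1ℚ ∎

-- The falling factorial m (m - 1) ⋯ (m - n + 1).

falling : ℕ → ℕ → ℕ
falling m       zero    = 1
falling zero    (suc n) = 0
falling (suc m) (suc n) = suc m ℕ.* falling m n

-- falling m (n + 1) = (m - n) falling m n.

falling-suc : ∀ m n → falling m (suc n) ℕ.+ n ℕ.* falling m n ≡ m ℕ.* falling m n
falling-suc zero    zero    = refl
falling-suc zero    (suc n) = ℕₚ.*-zeroʳ n
falling-suc (suc m) zero    = ℕₚ.+-identityʳ _
falling-suc (suc m) (suc n) = trans
  (regroup m n (falling m (suc n)) (falling m n))
  (trans (cong (λ k → suc m ℕ.* (k ℕ.+ falling m n)) (falling-suc m n))
         (collect m (falling m n)))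
  where
  regroup : ∀ m n f g → suc m ℕ.* f ℕ.+ suc n ℕ.* (suc m ℕ.* g) ≡ suc m ℕ.* (f ℕ.+ n ℕ.* g ℕ.+ g)
  regroup = ℕ-Solver.solve-∀
  collect : ∀ m g → suc m ℕ.* (m ℕ.* g ℕ.+ g) ≡ suc m ℕ.* (suc m ℕ.* g)
  collect = ℕ-Solver.solve-∀

-- 1/ α !ᵥ = 1 / Π αᵢ!

1/_!ᵥ : ∀ {n} → MultiIndex n → ℚ
1/ []    !ᵥ = 1ℚ
1/ a ∷ α !ᵥ = 1/ a ! ℚ.* 1/ α !ᵥ

1/replicate-0!ᵥ : ∀ n → 1/ replicate n 0 !ᵥ ≡ 1ℚ
1/replicate-0!ᵥ zero    = refl
1/replicate-0!ᵥ (suc n) = trans (ℚₚ.*-identityˡ _) (1/replicate-0!ᵥ n)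

shift-1/! : ∀ {n} i (α : MultiIndex n) → shift i 1/_!ᵥ α ≡ ι (lookup α i) ℚ.* 1/ α !ᵥ
shift-1/! zero    (zero  ∷ α) = sym (ℚₚ.*-zeroˡ (1/ zero ∷ α !ᵥ))
shift-1/! zero    (suc a ∷ α) = trans (cong (ℚ._* 1/ α !ᵥ) (sym (ι-*-1/! a)))
                                      (ℚₚ.*-assoc (ι (suc a)) 1/ suc a ! 1/ α !ᵥ)
shift-1/! (suc i) (a ∷ α)     = begin
  shift i (λ β → 1/ a ! ℚ.* 1/ β !ᵥ) α            ≡⟨ shift-scale i 1/ a ! 1/_!ᵥ α ⟩
  1/ a ! ℚ.* shift i 1/_!ᵥ α                      ≡⟨ cong (1/ a ! ℚ.*_) (shift-1/! i α) ⟩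
  1/ a ! ℚ.* (ι (lookup α i) ℚ.* 1/ α !ᵥ)         ≡⟨ x∙yz≈y∙xz 1/ a ! (ι (lookup α i)) 1/ α !ᵥ ⟩
  ι (lookup α i) ℚ.* (1/ a ! ℚ.* 1/ α !ᵥ)         ∎

Σ-ι-weighted : ∀ {n} (c : Fin n → ℕ) α x →
               sumℚ (λ i → ι (c i) ℚ.* (ι (lookup α i) ℚ.* x)) ≡ ι (weighted c α) ℚ.* x
Σ-ι-weighted c []      x = sym (ℚₚ.*-zeroˡ x)
Σ-ι-weighted c (a ∷ α) x = begin
  ι (c zero) ℚ.* (ι a ℚ.* x) ℚ.+ sumℚ (λ i → ι (c (suc i)) ℚ.* (ι (lookup α i) ℚ.* x))
    ≡⟨ cong₂ ℚ._+_ (sym (ℚₚ.*-assoc (ι (c zero)) (ι a) x)) (Σ-ι-weighted (c ∘ suc) α x) ⟩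
  ι (c zero) ℚ.* ι a ℚ.* x ℚ.+ ι (weighted (c ∘ suc) α) ℚ.* x
    ≡⟨ ℚₚ.*-distribʳ-+ x (ι (c zero) ℚ.* ι a) _ ⟨
  (ι (c zero) ℚ.* ι a ℚ.+ ι (weighted (c ∘ suc) α)) ℚ.* x
    ≡⟨ cong (ℚ._* x) (cong (ℚ._+ _) (ι-* (c zero) a)) ⟨
  (ι (c zero ℕ.* a) ℚ.+ ι (weighted (c ∘ suc) α)) ℚ.* x
    ≡⟨ cong (ℚ._* x) (ι-+ (c zero ℕ.* a) _) ⟨
  ι (weighted c (a ∷ α)) ℚ.* x ∎

monomial-refl : ∀ {n} (α : MultiIndex n) → monomial α α ≡ 1ℚ
monomial-refl α with ≡-dec ℕₚ._≟_ α α
... | yes _   = refl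
... | no  α≢α = ⊥-elim (α≢α refl)

1#-nonconstant : ∀ {n N} (α : MultiIndex n) → total α ≡ suc N → monomial (replicate n 0) α ≡ 0ℚ
1#-nonconstant {n} α eq with ≡-dec ℕₚ._≟_ (replicate n 0) α
... | no  _    = refl
... | yes refl with () ← trans (sym eq) (weighted-replicate-0 {n} (λ _ → 1))

------------------------------------------------------------------------
-- The coefficients of the powers of the hyper-Catalan series

-- The exponent of S that goes with the variable t i, which stands for t₂₊ᵢ.

degrees : ∀ {D} → Fin D → ℕ
degrees i = 2 ℕ.+ toℕ i

module _ {D : ℕ} {S : PowerSeries D} (isHC : IsHyperCatalan D S) where
  open RawRing (powerSeriesRawRing D) using (rawSemiring)
  open RawSemiringDefs rawSemiring using (_^_)

  private
    K : MultiIndex D → ℕ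
    K = weighted degrees

  power-constantTerm : ∀ j → (S ^ j) (replicate D 0) ≡ 1ℚ
  power-constantTerm zero    = monomial-refl (replicate D 0)
  power-constantTerm (suc j) = begin
    (S ^ suc j) (replicate D 0)
      ≡⟨ hyperCatalan-power-step isHC j (replicate D 0) ⟩
    (S ^ j) (replicate D 0) ℚ.+ sumℚ (λ i → shift i (S ^ (degrees i ℕ.+ j)) (replicate D 0))
      ≡⟨ cong₂ ℚ._+_ (power-constantTerm j)
           (sum-cong-≗ λ i → shift-replicate-0 i (S ^ (degrees i ℕ.+ j))) ⟩
    1ℚ ℚ.+ sumℚ {D} (λ _ → 0ℚ)
      ≡⟨ cong (1ℚ ℚ.+_) (sum-replicate-zero D) ⟩
    1ℚ ∎

  -- For |α| = N this says [t ^ α] S ^ j = j (K + j - 1)! / ((K + j - N)! Π αᵢ!), multiplied by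
  -- K + j; this form also covers K + j = 0.

  PowerCoefficient : ℕ → MultiIndex D → ℕ → Set
  PowerCoefficient N α j =
    ι (K α ℕ.+ j) ℚ.* (S ^ j) α ≡ ι (j ℕ.* falling (K α ℕ.+ j) N) ℚ.* 1/ α !ᵥ

  power-coefficient-step : ∀ N α → total α ≡ suc N → ∀ j →
    (∀ β → total β ≡ N → ∀ k → PowerCoefficient N β k) →
    PowerCoefficient (suc N) α j → PowerCoefficient (suc N) α (suc j)
  power-coefficient-step N α |α|≡1+N j IH-N IH-j = begin
    ι (K α ℕ.+ suc j) ℚ.* (S ^ suc j) α
      ≡⟨ cong₂ ℚ._*_ (cong ι (ℕₚ.+-suc (K α) j)) reduced ⟩
    ι (suc T) ℚ.* (ι (suc j ℕ.* falling T N) ℚ.* 1/ α !ᵥ)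
      ≡⟨ ℚₚ.*-assoc (ι (suc T)) _ _ ⟨
    ι (suc T) ℚ.* ι (suc j ℕ.* falling T N) ℚ.* 1/ α !ᵥ
      ≡⟨ cong (ℚ._* 1/ α !ᵥ) (ι-* (suc T) (suc j ℕ.* falling T N)) ⟨
    ι (suc T ℕ.* (suc j ℕ.* falling T N)) ℚ.* 1/ α !ᵥ
      ≡⟨ cong (λ k → ι k ℚ.* 1/ α !ᵥ) (swap (suc T) (suc j) (falling T N)) ⟩
    ι (suc j ℕ.* falling (suc T) (suc N)) ℚ.* 1/ α !ᵥ
      ≡⟨ cong (λ k → ι (suc j ℕ.* falling k (suc N)) ℚ.* 1/ α !ᵥ) (ℕₚ.+-suc (K α) j) ⟨
    ι (suc j ℕ.* falling (K α ℕ.+ suc j) (suc N)) ℚ.* 1/ α !ᵥ ∎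
    where
    T : ℕ
    T = K α ℕ.+ j

    swap : ∀ x y z → x ℕ.* (y ℕ.* z) ≡ y ℕ.* (x ℕ.* z)
    swap = ℕ-Solver.solve-∀

    -- K α ≥ |α|, hence T is positive and can be cancelled.
    T-nonZero : NonZero T
    T-nonZero = subst NonZero (sym (begin
      K α ℕ.+ j
        ≡⟨ cong (ℕ._+ j) (trans (weighted-cong (λ i → ℕₚ.+-comm 1 (suc (toℕ i))) α)
             (weighted-+ (λ i → suc (toℕ i)) 1 α)) ⟩
      W ℕ.+ 1 ℕ.* total α ℕ.+ j
        ≡⟨ cong (λ k → W ℕ.+ 1 ℕ.* k ℕ.+ j) |α|≡1+N ⟩
      W ℕ.+ 1 ℕ.* suc N ℕ.+ j
        ≡⟨ positive W N j ⟩
      suc (W ℕ.+ N ℕ.+ j) ∎)) _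
      where
      W : ℕ
      W = weighted (λ i → suc (toℕ i)) α
      positive : ∀ w n j → w ℕ.+ 1 ℕ.* suc n ℕ.+ j ≡ suc (w ℕ.+ n ℕ.+ j)
      positive = ℕ-Solver.solve-∀

    -- The induction hypothesis at α - eᵢ: K drops by degrees i, so T is unchanged.
    shifted : ∀ i β → updateAt β i suc ≡ α →
              ι T ℚ.* (S ^ (degrees i ℕ.+ j)) β
                ≡ ι (falling T N) ℚ.* (ι (degrees i ℕ.+ j) ℚ.* 1/ β !ᵥ)
    shifted i β refl = begin
      ι T ℚ.* (S ^ k) β
        ≡⟨ cong (λ m → ι m ℚ.* (S ^ k) β) T≡ ⟩
      ι (K β ℕ.+ k) ℚ.* (S ^ k) β
        ≡⟨ IH-N β (ℕₚ.suc-injective (trans (sym (weighted-updateAt (λ _ → 1) i β)) |α|≡1+N)) k ⟩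
      ι (k ℕ.* falling (K β ℕ.+ k) N) ℚ.* 1/ β !ᵥ
        ≡⟨ cong (λ m → ι (k ℕ.* falling m N) ℚ.* 1/ β !ᵥ) T≡ ⟨
      ι (k ℕ.* falling T N) ℚ.* 1/ β !ᵥ
        ≡⟨ cong (ℚ._* 1/ β !ᵥ) (trans (cong ι (ℕₚ.*-comm k (falling T N))) (ι-* (falling T N) k)) ⟩
      ι (falling T N) ℚ.* ι k ℚ.* 1/ β !ᵥ
        ≡⟨ ℚₚ.*-assoc (ι (falling T N)) (ι k) 1/ β !ᵥ ⟩
      ι (falling T N) ℚ.* (ι k ℚ.* 1/ β !ᵥ) ∎
      where
      k : ℕ
      k = degrees i ℕ.+ j
      rearrange : ∀ x y z → x ℕ.+ y ℕ.+ z ≡ y ℕ.+ (x ℕ.+ z)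
      rearrange = ℕ-Solver.solve-∀
      T≡ : T ≡ K β ℕ.+ k
      T≡ = trans (cong (ℕ._+ j) (weighted-updateAt degrees i β)) (rearrange (degrees i) (K β) j)

    -- Summing over i turns the factors degrees i + j into Σ (degrees i + j) αᵢ = K + j (N + 1).
    Σ-shifted : ι T ℚ.* sumℚ (λ i → shift i (S ^ (degrees i ℕ.+ j)) α)
                  ≡ ι (falling T N ℕ.* (K α ℕ.+ j ℕ.* suc N)) ℚ.* 1/ α !ᵥ
    Σ-shifted = begin
      ι T ℚ.* sumℚ (λ i → shift i (S ^ (degrees i ℕ.+ j)) α)
        ≡⟨ *-distribˡ-sum (ι T) (λ i → shift i (S ^ (degrees i ℕ.+ j)) α) ⟩
      sumℚ (λ i → ι T ℚ.* shift i (S ^ (degrees i ℕ.+ j)) α)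
        ≡⟨ sum-cong-≗ (λ i → begin
             ι T ℚ.* shift i (S ^ (degrees i ℕ.+ j)) α
               ≡⟨ shift-scale i (ι T) (S ^ (degrees i ℕ.+ j)) α ⟨
             shift i (λ β → ι T ℚ.* (S ^ (degrees i ℕ.+ j)) β) α
               ≡⟨ shift-cong i α (shifted i) ⟩
             shift i (λ β → ι (falling T N) ℚ.* (ι (degrees i ℕ.+ j) ℚ.* 1/ β !ᵥ)) α
               ≡⟨ shift-scale i (ι (falling T N)) (λ β → ι (degrees i ℕ.+ j) ℚ.* 1/ β !ᵥ) α ⟩
             ι (falling T N) ℚ.* shift i (λ β → ι (degrees i ℕ.+ j) ℚ.* 1/ β !ᵥ) α
               ≡⟨ cong (ι (falling T N) ℚ.*_) (trans
                    (shift-scale i (ι (degrees i ℕ.+ j)) 1/_!ᵥ α)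
                    (cong (ι (degrees i ℕ.+ j) ℚ.*_) (shift-1/! i α))) ⟩
             ι (falling T N) ℚ.* (ι (degrees i ℕ.+ j) ℚ.* (ι (lookup α i) ℚ.* 1/ α !ᵥ)) ∎) ⟩
      sumℚ (λ i → ι (falling T N) ℚ.* (ι (degrees i ℕ.+ j) ℚ.* (ι (lookup α i) ℚ.* 1/ α !ᵥ)))
        ≡⟨ *-distribˡ-sum (ι (falling T N)) (λ i → ι (degrees i ℕ.+ j) ℚ.* (ι (lookup α i) ℚ.* 1/ α !ᵥ)) ⟨
      ι (falling T N) ℚ.* sumℚ (λ i → ι (degrees i ℕ.+ j) ℚ.* (ι (lookup α i) ℚ.* 1/ α !ᵥ))
        ≡⟨ cong (ι (falling T N) ℚ.*_) (Σ-ι-weighted (λ i → degrees i ℕ.+ j) α 1/ α !ᵥ) ⟩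
      ι (falling T N) ℚ.* (ι (weighted (λ i → degrees i ℕ.+ j) α) ℚ.* 1/ α !ᵥ)
        ≡⟨ cong (λ k → ι (falling T N) ℚ.* (ι k ℚ.* 1/ α !ᵥ))
             (trans (weighted-+ degrees j α) (cong (λ k → K α ℕ.+ j ℕ.* k) |α|≡1+N)) ⟩
      ι (falling T N) ℚ.* (ι (K α ℕ.+ j ℕ.* suc N) ℚ.* 1/ α !ᵥ)
        ≡⟨ ℚₚ.*-assoc (ι (falling T N)) _ _ ⟨
      ι (falling T N) ℚ.* ι (K α ℕ.+ j ℕ.* suc N) ℚ.* 1/ α !ᵥ
        ≡⟨ cong (ℚ._* 1/ α !ᵥ) (ι-* (falling T N) (K α ℕ.+ j ℕ.* suc N)) ⟨
      ι (falling T N ℕ.* (K α ℕ.+ j ℕ.* suc N)) ℚ.* 1/ α !ᵥ ∎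

    numerator : j ℕ.* falling T (suc N) ℕ.+ falling T N ℕ.* (K α ℕ.+ j ℕ.* suc N)
                  ≡ T ℕ.* (suc j ℕ.* falling T N)
    numerator = begin
      j ℕ.* falling T (suc N) ℕ.+ falling T N ℕ.* (K α ℕ.+ j ℕ.* suc N)
        ≡⟨ expand j (falling T (suc N)) (falling T N) (K α) N ⟩
      j ℕ.* (falling T (suc N) ℕ.+ N ℕ.* falling T N) ℕ.+ (K α ℕ.+ j) ℕ.* falling T N
        ≡⟨ cong (λ k → j ℕ.* k ℕ.+ T ℕ.* falling T N) (falling-suc T N) ⟩
      j ℕ.* (T ℕ.* falling T N) ℕ.+ T ℕ.* falling T N
        ≡⟨ collect j T (falling T N) ⟩
      T ℕ.* (suc j ℕ.* falling T N) ∎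
      where
      expand : ∀ j f′ f k n → j ℕ.* f′ ℕ.+ f ℕ.* (k ℕ.+ j ℕ.* suc n)
                              ≡ j ℕ.* (f′ ℕ.+ n ℕ.* f) ℕ.+ (k ℕ.+ j) ℕ.* f
      expand = ℕ-Solver.solve-∀
      collect : ∀ j t f → j ℕ.* (t ℕ.* f) ℕ.+ t ℕ.* f ≡ t ℕ.* (suc j ℕ.* f)
      collect = ℕ-Solver.solve-∀

    reduced-*T : ι T ℚ.* (S ^ suc j) α ≡ ι T ℚ.* (ι (suc j ℕ.* falling T N) ℚ.* 1/ α !ᵥ)
    reduced-*T = begin
      ι T ℚ.* (S ^ suc j) α
        ≡⟨ cong (ι T ℚ.*_) (hyperCatalan-power-step isHC j α) ⟩
      ι T ℚ.* ((S ^ j) α ℚ.+ sumℚ (λ i → shift i (S ^ (degrees i ℕ.+ j)) α))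
        ≡⟨ ℚₚ.*-distribˡ-+ (ι T) _ _ ⟩
      ι T ℚ.* (S ^ j) α ℚ.+ ι T ℚ.* sumℚ (λ i → shift i (S ^ (degrees i ℕ.+ j)) α)
        ≡⟨ cong₂ ℚ._+_ IH-j Σ-shifted ⟩
      ι (j ℕ.* falling T (suc N)) ℚ.* 1/ α !ᵥ
        ℚ.+ ι (falling T N ℕ.* (K α ℕ.+ j ℕ.* suc N)) ℚ.* 1/ α !ᵥ
        ≡⟨ ℚₚ.*-distribʳ-+ 1/ α !ᵥ (ι (j ℕ.* falling T (suc N))) _ ⟨
      (ι (j ℕ.* falling T (suc N)) ℚ.+ ι (falling T N ℕ.* (K α ℕ.+ j ℕ.* suc N))) ℚ.* 1/ α !ᵥ
        ≡⟨ cong (ℚ._* 1/ α !ᵥ) (trans (sym (ι-+ (j ℕ.* falling T (suc N)) _)) (cong ι numerator)) ⟩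
      ι (T ℕ.* (suc j ℕ.* falling T N)) ℚ.* 1/ α !ᵥ
        ≡⟨ cong (ℚ._* 1/ α !ᵥ) (ι-* T (suc j ℕ.* falling T N)) ⟩
      ι T ℚ.* ι (suc j ℕ.* falling T N) ℚ.* 1/ α !ᵥ
        ≡⟨ ℚₚ.*-assoc (ι T) _ _ ⟩
      ι T ℚ.* (ι (suc j ℕ.* falling T N) ℚ.* 1/ α !ᵥ) ∎

    reduced : (S ^ suc j) α ≡ ι (suc j ℕ.* falling T N) ℚ.* 1/ α !ᵥ
    reduced = ι-cancel T {{T-nonZero}} reduced-*T

  power-coefficient : ∀ N α → total α ≡ N → ∀ j → PowerCoefficient N α j
  power-coefficient zero    α |α|≡0 j with refl ← total≡0⇒≡0 α |α|≡0 = begin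
    ι (K α ℕ.+ j) ℚ.* (S ^ j) α
      ≡⟨ cong₂ (λ k x → ι (k ℕ.+ j) ℚ.* x) (weighted-replicate-0 {D} degrees) (power-constantTerm j) ⟩
    ι j ℚ.* 1ℚ
      ≡⟨ cong₂ (λ k x → ι k ℚ.* x) (ℕₚ.*-identityʳ j) (1/replicate-0!ᵥ D) ⟨
    ι (j ℕ.* 1) ℚ.* 1/ α !ᵥ ∎
  power-coefficient (suc N) α |α|≡1+N zero    = begin
    ι (K α ℕ.+ 0) ℚ.* (S ^ 0) α  ≡⟨ cong (ι (K α ℕ.+ 0) ℚ.*_) (1#-nonconstant α |α|≡1+N) ⟩
    ι (K α ℕ.+ 0) ℚ.* 0ℚ         ≡⟨ ℚₚ.*-zeroʳ (ι (K α ℕ.+ 0)) ⟩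
    0ℚ                           ≡⟨ ℚₚ.*-zeroˡ 1/ α !ᵥ ⟨
    0ℚ ℚ.* 1/ α !ᵥ               ∎
  power-coefficient (suc N) α |α|≡1+N (suc j) = power-coefficient-step N α |α|≡1+N j
    (power-coefficient N) (power-coefficient (suc N) α |α|≡1+N j)

  -- [t ^ α] S = (K! / (K - N)!) / Π αᵢ!  for  |α| = N + 1.

  hyperCatalan-coefficient : ∀ N α → total α ≡ suc N → S α ≡ ι (falling (K α) N) ℚ.* 1/ α !ᵥ
  hyperCatalan-coefficient N α |α|≡1+N = ι-cancel (suc (K α)) (begin
    ι (suc (K α)) ℚ.* S α
      ≡⟨ cong₂ (λ k x → ι k ℚ.* x) (ℕₚ.+-comm 1 (K α)) (sym (*-identityʳ S α)) ⟩
    ι (K α ℕ.+ 1) ℚ.* (S ^ 1) α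
      ≡⟨ power-coefficient (suc N) α |α|≡1+N 1 ⟩
    ι (1 ℕ.* falling (K α ℕ.+ 1) (suc N)) ℚ.* 1/ α !ᵥ
      ≡⟨ cong (λ k → ι k ℚ.* 1/ α !ᵥ) (trans
           (ℕₚ.*-identityˡ _)
           (cong (λ k → falling k (suc N)) (ℕₚ.+-comm (K α) 1))) ⟩
    ι (suc (K α) ℕ.* falling (K α) N) ℚ.* 1/ α !ᵥ
      ≡⟨ cong (ℚ._* 1/ α !ᵥ) (ι-* (suc (K α)) (falling (K α) N)) ⟩
    ι (suc (K α)) ℚ.* ι (falling (K α) N) ℚ.* 1/ α !ᵥ
      ≡⟨ ℚₚ.*-assoc (ι (suc (K α))) _ _ ⟩
    ι (suc (K α)) ℚ.* (ι (falling (K α) N) ℚ.* 1/ α !ᵥ) ∎)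
    where open CommutativeRing (powerSeriesRing D) using (*-identityʳ)

------------------------------------------------------------------------
-- Additive maps on products of powers

-- For an additive φ the sum over i of the values of φ (y ^^ β) / Π βⱼ! at β = α - eᵢ is
-- φ (Σ∂ y α) / Π αⱼ!, because lowering αᵢ by one multiplies 1 / Π αⱼ! by αᵢ.

module AdditiveMap {c ℓ : Level} (R : CommutativeRing c ℓ)
  (φ : CommutativeRing.Carrier R → ℚ)
  (φ-cong : ∀ {p q} → CommutativeRing._≈_ R p q → φ p ≡ φ q)
  (φ-0 : φ (CommutativeRing.0# R) ≡ 0ℚ)
  (φ-+ : ∀ p q → φ (CommutativeRing._+_ R p q) ≡ φ p ℚ.+ φ q)
  where
  open CommutativeRing R
    using (Carrier; _*_; 1#; *-assoc; *-congˡ; *-identityˡ; distribˡ; zeroˡ; zeroʳ)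
    renaming (sym to ≈-sym; trans to ≈-trans)
  open PowerProducts R using (_^^_; powerDeriv; Σ∂)
  open SemiringExp (CommutativeRing.semiring R) using (_^_)
  open SemiringMult (CommutativeRing.semiring R) using (_×_; ×-comm-*; ×-assoc-*)

  φ-× : ∀ n p → φ (n × p) ≡ ι n ℚ.* φ p
  φ-× zero    p = trans φ-0 (sym (ℚₚ.*-zeroˡ (φ p)))
  φ-× (suc n) p = trans (φ-+ p (n × p)) (trans
    (cong₂ ℚ._+_ (sym (ℚₚ.*-identityˡ (φ p))) (φ-× n p))
    (sym (ℚₚ.*-distribʳ-+ (φ p) 1ℚ (ι n))))

  -- The prefix A collects the powers already split off in the induction on α.

  Σ-shift-^^-* : ∀ {n} A (y : Fin n → Carrier) α →
    sumℚ (λ i → shift i (λ β → 1/ β !ᵥ ℚ.* φ (A * y ^^ β)) α) ≡ 1/ α !ᵥ ℚ.* φ (A * Σ∂ y α)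
  Σ-shift-^^-* A y []      = sym (trans (ℚₚ.*-identityˡ _) (trans (φ-cong (zeroʳ A)) φ-0))
  Σ-shift-^^-* A y (a ∷ α) = trans (cong₂ ℚ._+_ (first a) rest) combine
    where
    y₀ Y : Carrier
    y₀ = y zero
    Y  = (y ∘ suc) ^^ α

    first : ∀ a → shift zero (λ β → 1/ β !ᵥ ℚ.* φ (A * y ^^ β)) (a ∷ α)
                    ≡ 1/ a ∷ α !ᵥ ℚ.* φ (A * (powerDeriv y₀ a * Y))
    first zero    = sym (trans
      (cong (1/ zero ∷ α !ᵥ ℚ.*_)
        (trans (φ-cong (≈-trans (*-congˡ (zeroˡ Y)) (zeroʳ A))) φ-0))
      (ℚₚ.*-zeroʳ 1/ zero ∷ α !ᵥ))
    first (suc b) = trans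
      (cong (λ w → w ℚ.* 1/ α !ᵥ ℚ.* φ (A * (y₀ ^ b * Y))) (sym (ι-*-1/! b)))
      (trans (pullˡ (ι (suc b)) 1/ suc b ! 1/ α !ᵥ _)
        (cong (1/ suc b ∷ α !ᵥ ℚ.*_) (trans
          (sym (φ-× (suc b) (A * (y₀ ^ b * Y))))
          (φ-cong (≈-trans (≈-sym (×-comm-* (suc b) A (y₀ ^ b * Y)))
                           (*-congˡ (≈-sym (×-assoc-* (suc b) (y₀ ^ b) Y))))))))
      where
      pullˡ : ∀ n x y z → n ℚ.* x ℚ.* y ℚ.* z ≡ x ℚ.* y ℚ.* (n ℚ.* z)
      pullˡ n x y z = trans (cong (ℚ._* z) (ℚₚ.*-assoc n x y))
        (trans (ℚₚ.*-assoc n (x ℚ.* y) z) (x∙yz≈y∙xz n (x ℚ.* y) z))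

    rest : sumℚ (λ i → shift i (λ β → 1/ a ∷ β !ᵥ ℚ.* φ (A * (y₀ ^ a * (y ∘ suc) ^^ β))) α)
             ≡ 1/ a ∷ α !ᵥ ℚ.* φ (A * (y₀ ^ a * Σ∂ (y ∘ suc) α))
    rest = trans
      (sum-cong-≗ λ i → trans
        (shift-cong i α λ β _ → trans
          (ℚₚ.*-assoc 1/ a ! 1/ β !ᵥ _)
          (cong (λ z → 1/ a ! ℚ.* (1/ β !ᵥ ℚ.* z)) (φ-cong (≈-sym (*-assoc A (y₀ ^ a) _)))))
        (shift-scale i 1/ a ! (λ β → 1/ β !ᵥ ℚ.* φ (A * y₀ ^ a * (y ∘ suc) ^^ β)) α))
      (trans (sym (*-distribˡ-sum 1/ a !
          (λ i → shift i (λ β → 1/ β !ᵥ ℚ.* φ (A * y₀ ^ a * (y ∘ suc) ^^ β)) α)))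
        (trans (cong (1/ a ! ℚ.*_) (Σ-shift-^^-* (A * y₀ ^ a) (y ∘ suc) α))
          (trans (sym (ℚₚ.*-assoc 1/ a ! 1/ α !ᵥ _))
            (cong (1/ a ∷ α !ᵥ ℚ.*_) (φ-cong (*-assoc A (y₀ ^ a) _))))))

    combine : 1/ a ∷ α !ᵥ ℚ.* φ (A * (powerDeriv y₀ a * Y))
                ℚ.+ 1/ a ∷ α !ᵥ ℚ.* φ (A * (y₀ ^ a * Σ∂ (y ∘ suc) α))
              ≡ 1/ a ∷ α !ᵥ ℚ.* φ (A * Σ∂ y (a ∷ α))
    combine = trans (sym (ℚₚ.*-distribˡ-+ 1/ a ∷ α !ᵥ _ _))
      (cong (1/ a ∷ α !ᵥ ℚ.*_) (trans (sym (φ-+ _ _))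
        (φ-cong (≈-sym (distribˡ A (powerDeriv y₀ a * Y) (y₀ ^ a * Σ∂ (y ∘ suc) α))))))

  Σ-shift-^^ : ∀ {n} (y : Fin n → Carrier) α →
    sumℚ (λ i → shift i (λ β → 1/ β !ᵥ ℚ.* φ (y ^^ β)) α) ≡ 1/ α !ᵥ ℚ.* φ (Σ∂ y α)
  Σ-shift-^^ y α = trans
    (sum-cong-≗ λ i → shift-cong i α λ β _ →
      cong (1/ β !ᵥ ℚ.*_) (φ-cong (≈-sym (*-identityˡ (y ^^ β)))))
    (trans (Σ-shift-^^-* 1# y α) (cong (1/ α !ᵥ ℚ.*_) (φ-cong (*-identityˡ (Σ∂ y α)))))

------------------------------------------------------------------------
-- Polynomials in z

ℚ-ring ℚ[z]-ring ℚ[z][x]-ring : CommutativeRing 0ℓ 0ℓ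
ℚ-ring       = ℚₚ.+-*-commutativeRing
ℚ[z]-ring    = Polynomials.polynomialRing ℚ-ring
ℚ[z][x]-ring = Polynomials.polynomialRing ℚ[z]-ring

-- Z and ZX qualify the operations and laws of ℚ[z] and of ℚ[z][x].

module Z  = CommutativeRing ℚ[z]-ring
module ZX = CommutativeRing ℚ[z][x]-ring

open SemiringExp Z.semiring using (_^_)

z : Z.Carrier
z = 0ℚ ∷ 1ℚ ∷ []

1+z≈1+z : 1+z Z.≈ Z.1# Z.+ z
1+z≈1+z zero          = refl
1+z≈1+z (suc zero)    = refl
1+z≈1+z (suc (suc _)) = refl

coeff-z* : ∀ p j → [z^ j ] (z Z.* p) ≡ [z^ j ] (0ℚ ∷ p)
coeff-z* p zero    = PolynomialCalculus.X*-assoc ℚ-ring (1ℚ ∷ []) p zero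
coeff-z* p (suc j) = trans (PolynomialCalculus.X*-assoc ℚ-ring (1ℚ ∷ []) p (suc j)) (Z.*-identityˡ p j)

coeff-z^* : ∀ n p → [z^ n ] (z ^ suc n Z.* p) ≡ 0ℚ
coeff-z^* n p = trans (Z.*-assoc z (z ^ n) p n) (trans (coeff-z* (z ^ n Z.* p) n) (low n))
  where
  low : ∀ n → [z^ n ] (0ℚ ∷ z ^ n Z.* p) ≡ 0ℚ
  low zero    = refl
  low (suc n) = coeff-z^* n p

coeff-1+z* : ∀ p j → [z^ j ] (1+z Z.* p) ≡ [z^ j ] p ℚ.+ [z^ j ] (0ℚ ∷ p)
coeff-1+z* p j = trans (Z.*-congʳ {p} {1+z} {Z.1# Z.+ z} 1+z≈1+z j)
  (trans (Z.distribʳ p Z.1# z j)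
  (trans (Polynomials.coeff-+ ℚ-ring (Z.1# Z.* p) (z Z.* p) j)
    (cong₂ ℚ._+_ (Z.*-identityˡ p j) (coeff-z* p j))))

-- The binomial coefficients: N! [z ^ N] (1 + z) ^ K = K (K - 1) ⋯ (K - N + 1).

coeff-[1+z]^ : ∀ K N → ι (N !) ℚ.* [z^ N ] (1+z ^ K) ≡ ι (falling K N)
coeff-[1+z]^ zero    zero    = refl
coeff-[1+z]^ zero    (suc N) = ℚₚ.*-zeroʳ (ι (suc N !))
coeff-[1+z]^ (suc K) zero    = begin
  1ℚ ℚ.* [z^ 0 ] (1+z Z.* 1+z ^ K)      ≡⟨ cong (1ℚ ℚ.*_) (coeff-1+z* (1+z ^ K) 0) ⟩
  1ℚ ℚ.* ([z^ 0 ] (1+z ^ K) ℚ.+ 0ℚ)     ≡⟨ cong (1ℚ ℚ.*_) (ℚₚ.+-identityʳ ([z^ 0 ] (1+z ^ K))) ⟩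
  1ℚ ℚ.* [z^ 0 ] (1+z ^ K)              ≡⟨ coeff-[1+z]^ K 0 ⟩
  ι (falling K 0)                       ∎
coeff-[1+z]^ (suc K) (suc N) = begin
  ι (suc N !) ℚ.* [z^ suc N ] (1+z Z.* 1+z ^ K)
    ≡⟨ cong (ι (suc N !) ℚ.*_) (coeff-1+z* (1+z ^ K) (suc N)) ⟩
  ι (suc N !) ℚ.* ([z^ suc N ] (1+z ^ K) ℚ.+ [z^ N ] (1+z ^ K))
    ≡⟨ ℚₚ.*-distribˡ-+ (ι (suc N !)) _ _ ⟩
  ι (suc N !) ℚ.* [z^ suc N ] (1+z ^ K) ℚ.+ ι (suc N !) ℚ.* [z^ N ] (1+z ^ K)
    ≡⟨ cong₂ ℚ._+_ (coeff-[1+z]^ K (suc N)) (begin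
         ι (suc N !) ℚ.* [z^ N ] (1+z ^ K)
           ≡⟨ cong (ℚ._* [z^ N ] (1+z ^ K)) (ι-* (suc N) (N !)) ⟩
         ι (suc N) ℚ.* ι (N !) ℚ.* [z^ N ] (1+z ^ K)
           ≡⟨ ℚₚ.*-assoc (ι (suc N)) (ι (N !)) _ ⟩
         ι (suc N) ℚ.* (ι (N !) ℚ.* [z^ N ] (1+z ^ K))
           ≡⟨ cong (ι (suc N) ℚ.*_) (coeff-[1+z]^ K N) ⟩
         ι (suc N) ℚ.* ι (falling K N)
           ≡⟨ ι-* (suc N) (falling K N) ⟨
         ι (suc N ℕ.* falling K N) ∎) ⟩
  ι (falling K (suc N)) ℚ.+ ι (suc N ℕ.* falling K N)
    ≡⟨ ι-+ (falling K (suc N)) (suc N ℕ.* falling K N) ⟨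
  ι (falling K (suc N) ℕ.+ suc N ℕ.* falling K N)
    ≡⟨ cong ι (trans (regroup (falling K (suc N)) N (falling K N))
                     (cong (falling K N ℕ.+_) (falling-suc K N))) ⟩
  ι (falling (suc K) (suc N)) ∎
  where
  regroup : ∀ x n f → x ℕ.+ suc n ℕ.* f ≡ f ℕ.+ (x ℕ.+ n ℕ.* f)
  regroup = ℕ-Solver.solve-∀

------------------------------------------------------------------------
-- Integration over x

open PolynomialCalculus ℚ[z]-ring using (functional; functional-cong; functional-+; functional-deriv;
  eval₀; eval₁; eval₀-*; eval₁-*; deriv; deriv-*)
open SemiringMult Z.semiring using () renaming (_×_ to _×ᶻ_)

coeff-const* : ∀ c p j → [z^ j ] ((c ∷ []) Z.* p) ≡ c ℚ.* [z^ j ] p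
coeff-const* c p j = trans (Polynomials.coeff-+ ℚ-ring (map (c ℚ.*_) p) (0ℚ ∷ []) j)
  (trans (cong₂ ℚ._+_ (Polynomials.coeff-scale ℚ-ring c p j) (zeros j)) (ℚₚ.+-identityʳ _))
  where
  zeros : ∀ j → [z^ j ] (0ℚ ∷ []) ≡ 0ℚ
  zeros zero    = refl
  zeros (suc j) = refl

coeff-× : ∀ n p j → [z^ j ] (n ×ᶻ p) ≡ ι n ℚ.* [z^ j ] p
coeff-× zero    p j = sym (ℚₚ.*-zeroˡ ([z^ j ] p))
coeff-× (suc n) p j = trans (Polynomials.coeff-+ ℚ-ring p (n ×ᶻ p) j) (trans
  (cong₂ ℚ._+_ (sym (ℚₚ.*-identityˡ ([z^ j ] p))) (coeff-× n p j))
  (sym (ℚₚ.*-distribʳ-+ ([z^ j ] p) 1ℚ (ι n))))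

-- ∫₀¹ as a linear functional.

integral : ZX.Carrier → Z.Carrier
integral = functional (λ i → recip i ∷ [])

integral-correct : ∀ p → ∫₀¹ p dx Z.≈ integral p
integral-correct = go recip
  where
  open RawSemiringDefs (RawRing.rawSemiring ℚ[z]) using (sum)
  go : ∀ c p → sum {length p} (λ i → map (c (toℕ i) ℚ.*_) (lookupₗ p i))
                 Z.≈ functional (λ i → c i ∷ []) p
  go c []      j = refl
  go c (a ∷ p) j = trans
    (Polynomials.coeff-+ ℚ-ring (map (c 0 ℚ.*_) a) _ j)
    (trans (cong₂ ℚ._+_
      (trans (Polynomials.coeff-scale ℚ-ring (c 0) a j) (sym (coeff-const* (c 0) a j)))
      (go (c ∘ suc) p j))
    (sym (Polynomials.coeff-+ ℚ-ring ((c 0 ∷ []) Z.* a) (functional (λ i → c (suc i) ∷ []) p) j)))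

recip-inverse : ∀ i a → (recip i ∷ []) Z.* (suc i ×ᶻ a) Z.≈ a
recip-inverse i a j = begin
  [z^ j ] ((recip i ∷ []) Z.* (suc i ×ᶻ a))
    ≡⟨ coeff-const* (recip i) (suc i ×ᶻ a) j ⟩
  recip i ℚ.* [z^ j ] (suc i ×ᶻ a)
    ≡⟨ cong (recip i ℚ.*_) (coeff-× (suc i) a j) ⟩
  recip i ℚ.* (ι (suc i) ℚ.* [z^ j ] a)
    ≡⟨ ℚₚ.*-assoc (recip i) (ι (suc i)) _ ⟨
  recip i ℚ.* ι (suc i) ℚ.* [z^ j ] a
    ≡⟨ cong (ℚ._* [z^ j ] a) (trans (ℚₚ.*-comm (recip i) (ι (suc i))) (ι-*-recip i)) ⟩
  1ℚ ℚ.* [z^ j ] a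
    ≡⟨ ℚₚ.*-identityˡ _ ⟩
  [z^ j ] a ∎

-- extract N p = [z ^ N] (1 + z) ^ (2 N + 2) ∫₀¹ p dx.  For N = D M with D ≥ 1
-- the exponent is E D M.

extract : ℕ → ZX.Carrier → ℚ
extract N p = [z^ N ] (1+z ^ (2 ℕ.* N ℕ.+ 2) Z.* integral p)

extract-cong : ∀ N {p q} → p ZX.≈ q → extract N p ≡ extract N q
extract-cong N {p} {q} p≈q =
  Z.*-congˡ {1+z ^ (2 ℕ.* N ℕ.+ 2)} {integral p} {integral q} (functional-cong _ p q p≈q) N

extract-0 : ∀ N → extract N ZX.0# ≡ 0ℚ
extract-0 N = Z.zeroʳ (1+z ^ (2 ℕ.* N ℕ.+ 2)) N

extract-+ : ∀ N p q → extract N (p ZX.+ q) ≡ extract N p ℚ.+ extract N q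
extract-+ N p q = trans
  (Z.*-congˡ {U} {integral (p ZX.+ q)} {integral p Z.+ integral q} (functional-+ _ p q) N)
  (trans (Z.distribˡ U (integral p) (integral q) N)
    (Polynomials.coeff-+ ℚ-ring (U Z.* integral p) (U Z.* integral q) N))
  where
  U : Z.Carrier
  U = 1+z ^ (2 ℕ.* N ℕ.+ 2)

------------------------------------------------------------------------
-- The integrand

-- factor i = (1 + z) ^ i - x

factor : ∀ {D} → Fin D → ZX.Carrier
factor i = ((1+z ^ toℕ i) ∷ []) ZX.+ (ZX.- (Z.0# ∷ Z.1# ∷ []))

open PowerProducts ℚ[z][x]-ring using (_^^_; Σ∂; ^^-replicate; module Derivation)
module ZPowers = PowerProducts ℚ[z]-ring

deriv-factor : ∀ {D} (i : Fin D) → deriv (factor i) ZX.+ ZX.1# ZX.≈ ZX.0#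
deriv-factor i zero    zero    = refl
deriv-factor i zero    (suc _) = refl
deriv-factor i (suc _) _       = refl

-- At x = 0 the factors are powers of 1 + z.

eval₀-^^ : ∀ {D} (α : MultiIndex D) → eval₀ (factor ^^ α) Z.≈ 1+z ^ weighted toℕ α
eval₀-^^ α = Z.trans {eval₀ (factor ^^ α)} {(eval₀ ∘ factor) ZPowers.^^ α} {1+z ^ weighted toℕ α}
  (^^-homo ℚ[z][x]-ring ℚ[z]-ring eval₀ (λ _ → refl) eval₀-* factor α)
  (Z.trans {(eval₀ ∘ factor) ZPowers.^^ α} {(λ i → 1+z ^ toℕ i) ZPowers.^^ α} {1+z ^ weighted toℕ α}
    (ZPowers.^^-cong {x = eval₀ ∘ factor} {y = λ i → 1+z ^ toℕ i} (λ i → Z.+-identityʳ (1+z ^ toℕ i)) α)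
    (ZPowers.^^-weighted 1+z toℕ α))

-- At x = 1 each factor is divisible by z; cofactor α is the quotient of the product by z ^ |α|.

cofactor : ∀ {D} → MultiIndex D → Z.Carrier
cofactor = (λ i → geometric ℚ[z]-ring 1+z (toℕ i)) ZPowers.^^_

eval₁-^^ : ∀ {D} (α : MultiIndex D) → eval₁ (factor ^^ α) Z.≈ z ^ total α Z.* cofactor α
eval₁-^^ {D} α j = begin
  [z^ j ] (eval₁ (factor ^^ α))
    ≡⟨ ^^-homo ℚ[z][x]-ring ℚ[z]-ring eval₁ eval₁-1 eval₁-* factor α j ⟩
  [z^ j ] ((eval₁ ∘ factor) ZPowers.^^ α)
    ≡⟨ ZPowers.^^-cong {x = eval₁ ∘ factor} {y = λ i → z ^ 1 Z.* g i} eval₁-factor α j ⟩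
  [z^ j ] ((λ i → z ^ 1 Z.* g i) ZPowers.^^ α)
    ≡⟨ ZPowers.^^-distrib-* (λ _ → z ^ 1) g α j ⟩
  [z^ j ] ((λ _ → z ^ 1) ZPowers.^^ α Z.* cofactor α)
    ≡⟨ Z.*-congʳ {cofactor α} {(λ _ → z ^ 1) ZPowers.^^ α} {z ^ total α}
         (ZPowers.^^-weighted z (λ _ → 1) α) j ⟩
  [z^ j ] (z ^ total α Z.* cofactor α) ∎
  where
  g : Fin D → Z.Carrier
  g i = geometric ℚ[z]-ring 1+z (toℕ i)

  eval₁-1 : eval₁ ZX.1# Z.≈ Z.1#
  eval₁-1 zero          = refl
  eval₁-1 (suc zero)    = refl
  eval₁-1 (suc (suc _)) = refl

  eval₁-factor : ∀ i → eval₁ (factor i) Z.≈ z ^ 1 Z.* g i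
  eval₁-factor i k = trans (power-minus-1 ℚ[z]-ring 1+z z 1+z≈1+z (toℕ i) k)
    (Z.*-congʳ {g i} {z} {z ^ 1} (λ k → sym (Z.*-identityʳ z k)) k)

extract-Σ∂ : ∀ {D} N (α : MultiIndex D) → total α ≡ suc N →
             extract N (Σ∂ factor α) ≡ [z^ N ] (1+z ^ weighted degrees α)
extract-Σ∂ N α |α|≡1+N = begin
  extract N (Σ∂ factor α)
    ≡⟨ ℚₚ.+-identityʳ _ ⟨
  extract N (Σ∂ factor α) ℚ.+ 0ℚ
    ≡⟨ cong (extract N (Σ∂ factor α) ℚ.+_) (trans
         (cong (λ n → [z^ N ] (z ^ n Z.* V)) |α|≡1+N) (coeff-z^* N V)) ⟨
  extract N (Σ∂ factor α) ℚ.+ [z^ N ] (z ^ total α Z.* V)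
    ≡⟨ Polynomials.coeff-+ ℚ-ring (U Z.* integral (Σ∂ factor α)) (z ^ total α Z.* V) N ⟨
  [z^ N ] (U Z.* integral (Σ∂ factor α) Z.+ z ^ total α Z.* V)
    ≡⟨ endpoints ℚ[z]-ring {integral (Σ∂ factor α)} {integral (deriv Y)} {eval₀ Y} {eval₁ Y}
         1+z (weighted toℕ α) (2 ℕ.* N ℕ.+ 2) {z ^ total α} {cofactor α}
         sum-zero (functional-deriv _ recip-inverse Y) (eval₀-^^ α) (eval₁-^^ α) N ⟩
  [z^ N ] (1+z ^ (2 ℕ.* N ℕ.+ 2 ℕ.+ weighted toℕ α))
    ≡⟨ cong (λ k → [z^ N ] (1+z ^ k)) exponent ⟩
  [z^ N ] (1+z ^ weighted degrees α) ∎
  where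
  Y : ZX.Carrier
  Y = factor ^^ α
  U V : Z.Carrier
  U = 1+z ^ (2 ℕ.* N ℕ.+ 2)
  V = cofactor α Z.* U

  sum-zero : integral (Σ∂ factor α) Z.+ integral (deriv Y) Z.≈ Z.0#
  sum-zero j = trans (sym (functional-+ _ (Σ∂ factor α) (deriv Y) j))
    (functional-cong _ (Σ∂ factor α ZX.+ deriv Y) ZX.0#
      (Derivation.D-^^ deriv (λ _ _ → refl) deriv-* factor deriv-factor α) j)

  exponent : 2 ℕ.* N ℕ.+ 2 ℕ.+ weighted toℕ α ≡ weighted degrees α
  exponent = begin
    2 ℕ.* N ℕ.+ 2 ℕ.+ weighted toℕ α     ≡⟨ regroup N (weighted toℕ α) ⟩
    weighted toℕ α ℕ.+ 2 ℕ.* suc N       ≡⟨ cong (λ n → weighted toℕ α ℕ.+ 2 ℕ.* n) |α|≡1+N ⟨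
    weighted toℕ α ℕ.+ 2 ℕ.* total α     ≡⟨ weighted-+ toℕ 2 α ⟨
    weighted (λ i → toℕ i ℕ.+ 2) α       ≡⟨ weighted-cong (λ i → ℕₚ.+-comm (toℕ i) 2) α ⟩
    weighted degrees α                   ∎
    where
    regroup : ∀ n w → 2 ℕ.* n ℕ.+ 2 ℕ.+ w ≡ w ℕ.+ 2 ℕ.* suc n
    regroup = ℕ-Solver.solve-∀

------------------------------------------------------------------------
-- The coefficients of the Geode

-- |α|! / Π αᵢ! · [z ^ |α|] (1 + z) ^ (2 |α| + 2) ∫₀¹ Π ((1 + z) ^ i - x) ^ αᵢ dx

geodeCoefficient : ∀ {D} → PowerSeries D
geodeCoefficient α = ι (total α !) ℚ.* (1/ α !ᵥ ℚ.* extract (total α) (factor ^^ α))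

Σ-shift-geodeCoefficient : ∀ {D} N (α : MultiIndex D) → total α ≡ suc N →
  sumℚ (λ i → shift i geodeCoefficient α) ≡ ι (falling (weighted degrees α) N) ℚ.* 1/ α !ᵥ
Σ-shift-geodeCoefficient N α |α|≡1+N = begin
  sumℚ (λ i → shift i geodeCoefficient α)
    ≡⟨ sum-cong-≗ (λ i → trans
         (shift-cong i α λ β β+eᵢ≡α → cong (λ n → ι (n !) ℚ.* (1/ β !ᵥ ℚ.* extract n (factor ^^ β)))
           (ℕₚ.suc-injective (trans (sym (weighted-updateAt (λ _ → 1) i β))
             (trans (cong total β+eᵢ≡α) |α|≡1+N))))
         (shift-scale i (ι (N !)) summand α)) ⟩
  sumℚ (λ i → ι (N !) ℚ.* shift i summand α)
    ≡⟨ *-distribˡ-sum (ι (N !)) (λ i → shift i summand α) ⟨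
  ι (N !) ℚ.* sumℚ (λ i → shift i summand α)
    ≡⟨ cong (ι (N !) ℚ.*_) (AdditiveMap.Σ-shift-^^ ℚ[z][x]-ring (extract N)
         (λ {p} {q} → extract-cong N {p} {q}) (extract-0 N) (extract-+ N) factor α) ⟩
  ι (N !) ℚ.* (1/ α !ᵥ ℚ.* extract N (Σ∂ factor α))
    ≡⟨ cong (λ x → ι (N !) ℚ.* (1/ α !ᵥ ℚ.* x)) (extract-Σ∂ N α |α|≡1+N) ⟩
  ι (N !) ℚ.* (1/ α !ᵥ ℚ.* [z^ N ] (1+z ^ weighted degrees α))
    ≡⟨ cong (ι (N !) ℚ.*_) (ℚₚ.*-comm 1/ α !ᵥ _) ⟩
  ι (N !) ℚ.* ([z^ N ] (1+z ^ weighted degrees α) ℚ.* 1/ α !ᵥ)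
    ≡⟨ ℚₚ.*-assoc (ι (N !)) _ _ ⟨
  ι (N !) ℚ.* [z^ N ] (1+z ^ weighted degrees α) ℚ.* 1/ α !ᵥ
    ≡⟨ cong (ℚ._* 1/ α !ᵥ) (coeff-[1+z]^ (weighted degrees α) N) ⟩
  ι (falling (weighted degrees α) N) ℚ.* 1/ α !ᵥ ∎
  where
  summand : MultiIndex _ → ℚ
  summand β = 1/ β !ᵥ ℚ.* extract N (factor ^^ β)

open GroupProperties ℚₚ.+-0-group using () renaming (∙-cancelʳ to +-cancelʳ)

-- A series F is determined by its product with Σ tᵢ.  The coefficient of that product at α + e₀ is
-- F α plus values of F at multi-indices with a smaller total degree in the other variables.

Σ-shift-injective : ∀ {D} (F G : PowerSeries (suc D)) →
  (∀ N α → total α ≡ suc N → sumℚ (λ i → shift i F α) ≡ sumℚ (λ i → shift i G α)) →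
  ∀ α → F α ≡ G α
Σ-shift-injective {D} F G eq (a ∷ α) = go (total α) a α refl
  where
  go : ∀ n a (α : MultiIndex D) → total α ≡ n → F (a ∷ α) ≡ G (a ∷ α)
  go n a α |α|≡n = +-cancelʳ (sumℚ (λ i → shift (suc i) F (suc a ∷ α))) _ _ (trans
    (eq (a ℕ.+ 0 ℕ.+ total α) (suc a ∷ α) refl)
    (cong (G (a ∷ α) ℚ.+_) (sum-cong-≗ λ i → shift-cong i α λ β β+eᵢ≡α →
      sym (go′ n |α|≡n i β β+eᵢ≡α))))
    where
    go′ : ∀ n → total α ≡ n → ∀ i β → updateAt β i suc ≡ α → F (suc a ∷ β) ≡ G (suc a ∷ β)
    go′ n |α|≡n i β refl with n | trans (sym |α|≡n) (weighted-updateAt (λ _ → 1) i β)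
    ... | suc m | 1+m≡1+|β| = go m (suc a) β (ℕₚ.suc-injective (sym 1+m≡1+|β|))

geode-coefficient : ∀ {D} {S G : PowerSeries (suc D)} →
  IsHyperCatalan (suc D) S → IsGeode (suc D) S G → ∀ α → G α ≡ geodeCoefficient α
geode-coefficient {D} {S} {G} isHC isGeode = Σ-shift-injective G geodeCoefficient λ N α |α|≡1+N → begin
  sumℚ (λ i → shift i G α)
    ≡⟨ geode-step {S = S} {G} isGeode α ⟨
  S α ℚ.- monomial (replicate (suc D) 0) α
    ≡⟨ cong (λ x → S α ℚ.- x) (1#-nonconstant α |α|≡1+N) ⟩
  S α ℚ.+ 0ℚ
    ≡⟨ ℚₚ.+-identityʳ (S α) ⟩
  S α
    ≡⟨ hyperCatalan-coefficient isHC N α |α|≡1+N ⟩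
  ι (falling (weighted degrees α) N) ℚ.* 1/ α !ᵥ
    ≡⟨ Σ-shift-geodeCoefficient N α |α|≡1+N ⟨
  sumℚ (λ i → shift i geodeCoefficient α) ∎

------------------------------------------------------------------------
-- The diagonal

total-replicate : ∀ D M → total (replicate D M) ≡ D ℕ.* M
total-replicate zero    M = refl
total-replicate (suc D) M = cong₂ ℕ._+_ (ℕₚ.*-identityˡ M) (total-replicate D M)

ι-*-1/replicate! : ∀ D M → ι ((M !) ℕ.^ D) ℚ.* 1/ replicate D M !ᵥ ≡ 1ℚ
ι-*-1/replicate! zero    M = refl
ι-*-1/replicate! (suc D) M = begin
  ι (M ! ℕ.* (M !) ℕ.^ D) ℚ.* (1/ M ! ℚ.* w)
    ≡⟨ cong (ℚ._* (1/ M ! ℚ.* w)) (ι-* (M !) ((M !) ℕ.^ D)) ⟩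
  ι (M !) ℚ.* ι ((M !) ℕ.^ D) ℚ.* (1/ M ! ℚ.* w)
    ≡⟨ interchange (ι (M !)) (ι ((M !) ℕ.^ D)) 1/ M ! w ⟩
  ι (M !) ℚ.* 1/ M ! ℚ.* (ι ((M !) ℕ.^ D) ℚ.* w)
    ≡⟨ cong₂ ℚ._*_ (ι-!-*-1/! M) (ι-*-1/replicate! D M) ⟩
  1ℚ ∎
  where
  w : ℚ
  w = 1/ replicate D M !ᵥ

multinomial≡ : ∀ D M → multinomial D M ≡ ι ((D ℕ.* M) !) ℚ.* 1/ replicate D M !ᵥ
multinomial≡ D M = ι-cancel ((M !) ℕ.^ D) (begin
  ι ((M !) ℕ.^ D) ℚ.* multinomial D M
    ≡⟨ ι-*-/ ((D ℕ.* M) !) ((M !) ℕ.^ D) ⟩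
  ι ((D ℕ.* M) !)
    ≡⟨ ℚₚ.*-identityʳ _ ⟨
  ι ((D ℕ.* M) !) ℚ.* 1ℚ
    ≡⟨ cong (ι ((D ℕ.* M) !) ℚ.*_) (ι-*-1/replicate! D M) ⟨
  ι ((D ℕ.* M) !) ℚ.* (ι ((M !) ℕ.^ D) ℚ.* 1/ replicate D M !ᵥ)
    ≡⟨ x∙yz≈y∙xz (ι ((D ℕ.* M) !)) (ι ((M !) ℕ.^ D)) 1/ replicate D M !ᵥ ⟩
  ι ((M !) ℕ.^ D) ℚ.* (ι ((D ℕ.* M) !) ℚ.* 1/ replicate D M !ᵥ) ∎)
  where
  instance
    [M!]^D≢0 : NonZero ((M !) ℕ.^ D)
    [M!]^D≢0 = ℕₚ.m^n≢0 (M !) D {{ℕₚ._!≢0 M}}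

sumℕ : ∀ {n} → (Fin n → ℕ) → ℕ
sumℕ = RawMonoidDefs.sum ℕ.+-0-rawMonoid

Σ-+ : ∀ n c (f : Fin n → ℕ) → sumℕ (λ i → c ℕ.+ f i) ≡ n ℕ.* c ℕ.+ sumℕ f
Σ-+ zero    c f = refl
Σ-+ (suc n) c f = trans (cong (c ℕ.+ f zero ℕ.+_) (Σ-+ n c (f ∘ suc)))
  (regroup c (f zero) (n ℕ.* c) (sumℕ (f ∘ suc)))
  where
  regroup : ∀ c x y z → c ℕ.+ x ℕ.+ (y ℕ.+ z) ≡ c ℕ.+ y ℕ.+ (x ℕ.+ z)
  regroup = ℕ-Solver.solve-∀

Σ-toℕ : ∀ d → sumℕ {suc d} toℕ ℕ.* 2 ≡ d ℕ.* (d ℕ.+ 1)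
Σ-toℕ zero    = refl
Σ-toℕ (suc d) = trans (cong (ℕ._* 2) (Σ-+ (suc d) 1 toℕ)) (trans
  (ℕₚ.*-distribʳ-+ 2 (suc d ℕ.* 1) (sumℕ {suc d} toℕ))
  (trans (cong (suc d ℕ.* 1 ℕ.* 2 ℕ.+_) (Σ-toℕ d)) (collect d)))
  where
  collect : ∀ d → suc d ℕ.* 1 ℕ.* 2 ℕ.+ d ℕ.* (d ℕ.+ 1) ≡ suc d ℕ.* (suc d ℕ.+ 1)
  collect = ℕ-Solver.solve-∀

-- The sum of the exponents 2, …, D + 1 exceeds s (D - 1) by 2 D.

E≡ : ∀ d M → E (suc d) M ≡ 2 ℕ.* (suc d ℕ.* M) ℕ.+ 2
E≡ d M = cong (ℕ._+ 2) (begin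
  (sumℕ {suc d} (λ i → 2 ℕ.+ toℕ i) ∸ d ℕ.* (d ℕ.+ 1) ℕ./ 2) ℕ.* M
    ≡⟨ cong (λ k → (k ∸ d ℕ.* (d ℕ.+ 1) ℕ./ 2) ℕ.* M) (Σ-+ (suc d) 2 toℕ) ⟩
  (suc d ℕ.* 2 ℕ.+ sumℕ {suc d} toℕ ∸ d ℕ.* (d ℕ.+ 1) ℕ./ 2) ℕ.* M
    ≡⟨ cong (λ k → (suc d ℕ.* 2 ℕ.+ sumℕ {suc d} toℕ ∸ k ℕ./ 2) ℕ.* M) (Σ-toℕ d) ⟨
  (suc d ℕ.* 2 ℕ.+ sumℕ {suc d} toℕ ∸ sumℕ {suc d} toℕ ℕ.* 2 ℕ./ 2) ℕ.* M
    ≡⟨ cong (λ k → (suc d ℕ.* 2 ℕ.+ sumℕ {suc d} toℕ ∸ k) ℕ.* M) (ℕ.m*n/n≡m (sumℕ {suc d} toℕ) 2) ⟩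
  (suc d ℕ.* 2 ℕ.+ sumℕ {suc d} toℕ ∸ sumℕ {suc d} toℕ) ℕ.* M
    ≡⟨ cong (ℕ._* M) (ℕₚ.m+n∸n≡m (suc d ℕ.* 2) (sumℕ {suc d} toℕ)) ⟩
  suc d ℕ.* 2 ℕ.* M
    ≡⟨ regroup (suc d) M ⟩
  2 ℕ.* (suc d ℕ.* M) ∎)
  where
  regroup : ∀ n m → n ℕ.* 2 ℕ.* m ≡ 2 ℕ.* (n ℕ.* m)
  regroup = ℕ-Solver.solve-∀

geodeCoefficient-diagonal : ∀ d M → geodeCoefficient (replicate (suc d) M) ≡ closedForm (suc d) M
geodeCoefficient-diagonal d M = begin
  geodeCoefficient α
    ≡⟨ cong (λ n → ι (n !) ℚ.* (1/ α !ᵥ ℚ.* extract n (factor ^^ α))) (total-replicate D M) ⟩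
  ι ((D ℕ.* M) !) ℚ.* (1/ α !ᵥ ℚ.* extract (D ℕ.* M) (factor ^^ α))
    ≡⟨ ℚₚ.*-assoc (ι ((D ℕ.* M) !)) 1/ α !ᵥ _ ⟨
  ι ((D ℕ.* M) !) ℚ.* 1/ α !ᵥ ℚ.* extract (D ℕ.* M) (factor ^^ α)
    ≡⟨ cong₂ ℚ._*_ (sym (multinomial≡ D M)) (begin
         extract (D ℕ.* M) (factor ^^ α)
           ≡⟨ extract-cong (D ℕ.* M) {factor ^^ α} {h d ^ˣ M} (^^-replicate (factor {D}) M) ⟩
         [z^ D ℕ.* M ] (1+z ^ (2 ℕ.* (D ℕ.* M) ℕ.+ 2) Z.* integral (h d ^ˣ M))
           ≡⟨ cong (λ e → [z^ D ℕ.* M ] (1+z ^ e Z.* integral (h d ^ˣ M))) (E≡ d M) ⟨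
         [z^ D ℕ.* M ] (1+z ^ E D M Z.* integral (h d ^ˣ M))
           ≡⟨ Z.*-congˡ {1+z ^ E D M} {∫₀¹ h d ^ˣ M dx} {integral (h d ^ˣ M)}
                (integral-correct (h d ^ˣ M)) (D ℕ.* M) ⟨
         [z^ D ℕ.* M ] (1+z ^ E D M Z.* ∫₀¹ h d ^ˣ M dx) ∎) ⟩
  closedForm D M ∎
  where
  D : ℕ
  D = suc d
  α : MultiIndex D
  α = replicate D M
  open SemiringExp ZX.semiring using () renaming (_^_ to _^ˣ_)

theorem10p4 : (D M : ℕ) → 1 ≤ D →
    (S G : PowerSeries D) → IsHyperCatalan D S → IsGeode D S G →
    G (replicate D M) ≡ closedForm D M
theorem10p4 (suc d) M (s≤s _) S G isHC isGeode = trans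
  (geode-coefficient isHC isGeode (replicate (suc d) M))
  (geodeCoefficient-diagonal d M)
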